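{- Let $K=\mathbb{F}_q$ be a finite field. Let $\mathcal{G}$ be a bipartite simple graph on vertices $v_1,\ldots,v_{2k}$ with $s$ edges, every edge joining a vertex of $\{v_1,v_3,\ldots,v_{2k-1}\}$ to a vertex of $\{v_2,v_4,\ldots,v_{2k}\}$, and having the perfect matching $\{\{v_{2i-1},v_{2i}\}: i=1,\ldots,k\}$. Let $n_i=\deg v_i$, so $n_1+n_3+\cdots+n_{2k-1}=s$. Let $$\mathbb{Y}=\{[t_1,\ldots,t_1,t_3,\ldots,t_3,\ldots,t_{2k-1},\ldots,t_{2k-1}]\in\mathbb{P}^{s-1}: t_i\in K^*\},$$ where $t_i$ appears $n_i$ times for each $i=1,3,\ldots,2k-1$. Put $a_1=1$ and $a_j=n_1+n_3+\cdots+n_{2j-3}+1$ for $j=2,\ldots,k$ (so $a_j$ is the first index of the $j$-th block of coordinates). Then $\mathbb{Y}$ is a complete intersection. In fact, the vanishing ideal $I_{\mathbb{Y}}\subseteq S=K[X_1,\ldots,X_s]$ is generated by the union $\mathbb{W}_0\cup\mathbb{W}_1\cup\mathbb{W}_3\cup\cdots\cup\mathbb{W}_{2k-1}$ of the sets $$\mathbb{W}_0=\{X_{a_j}^{q-1}-X_1^{q-1}: j=2,\ldots,k\},$$ $$\mathbb{W}_{2j-1}=\{X_i-X_{a_j}: a_j+1\le i\le a_j+n_{2j-1}-1\},\qquad j=1,\ldots,k,$$ where $\mathbb{W}_{2j-1}=\emptyset$ if $n_{2j-1}=1$.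
   Context: $K^*=K\setminus\{0\}$ and $\mathbb{P}^{s-1}$ is the projective space over $K$. The vanishing ideal $I_{\mathbb{Y}}$ of a set $\mathbb{Y}\subseteq\mathbb{P}^{s-1}$ is the ideal of $S=K[X_1,\ldots,X_s]$ generated by the homogeneous polynomials vanishing at all points of $\mathbb{Y}$. A set $\mathbb{Y}\subseteq\mathbb{P}^{s-1}$ is called a complete intersection if $I_{\mathbb{Y}}$ is generated by a regular sequence of $s-1$ elements, i.e. $I_{\mathbb{Y}}=(f_1,\ldots,f_{s-1})$ where $f_1$ is not a zero divisor of $S$ and $f_i$ is not a zero divisor of $S/(f_1,\ldots,f_{i-1})$ for $i=2,\ldots,s-1$. -}

module Defs where

open import Level using (Level; 0ℓ; _⊔_)
open import Algebra.Bundles using (CommutativeRing; RawRing)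
import Algebra.Definitions.RawSemiring as Powers
open import Data.Bool.Base using (if_then_else_)
open import Data.Fin.Base as Fin using (Fin; zero; suc; toℕ; combine)
import Data.Fin.Properties as Fin
open import Data.List.Base as List
  using (List; []; _∷_; _++_; allFin; cartesianProduct; cartesianProductWith; filter; length)
open import Data.Nat.Base as ℕ using (ℕ; zero; suc; _∸_)
import Data.Nat.Properties as ℕ
open import Data.Product using (Σ; ∃-syntax; ∃!; _×_; _,_; proj₁; proj₂; uncurry)
open import Data.Sum.Base using (_⊎_)
open import Data.Vec.Base as Vec using (Vec; lookup; replicate; zipWith; _[_]≔_)
import Data.Vec.Properties as Vec
open import Data.Vec.Functional using (Vector)
open import Function.Base using (_∘_)
open import Function.Bundles using (Inverse)
open import Relation.Binary.Core using (Rel)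
open import Relation.Binary.Definitions using (Decidable; Symmetric; Irreflexive)
open import Relation.Binary.PropositionalEquality as ≡ using (_≡_; _≢_)
open import Relation.Nullary.Decidable using (does; _×-dec_)
open import Relation.Nullary.Negation using (¬_)
open import Relation.Unary using (Pred; _≐_; _∪_)

private
  variable
    c ℓ g : Level

------------------------------------------------------------------------
-- Graphs

record SimpleGraph (n : ℕ) : Set₁ where
  field
    Adj    : Rel (Fin n) 0ℓ
    adj?   : Decidable Adj
    sym    : Symmetric Adj
    irrefl : Irreflexive _≡_ Adj

module _ {n : ℕ} (G : SimpleGraph n) where
  open SimpleGraph G

  degree : Fin n → ℕ
  degree u = length (filter (adj? u) (allFin n))

  -- An edge {u , v} is counted once, as the pair with u < v.
  edges : List (Fin n × Fin n)
  edges = filter (λ (u , v) → (u Fin.<? v) ×-dec adj? u v)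
                 (cartesianProduct (allFin n) (allFin n))

  EdgesJoin : Pred (Fin n) 0ℓ → Pred (Fin n) 0ℓ → Set
  EdgesJoin A B = ∀ u v → Adj u v → (A u × B v) ⊎ (B u × A v)

  IsPerfectMatching : ∀ {k} → (Fin k → Fin n × Fin n) → Set
  IsPerfectMatching e =
    (∀ i → uncurry Adj (e i)) ×
    (∀ v → ∃! _≡_ λ i → v ≡ proj₁ (e i) ⊎ v ≡ proj₂ (e i))

-- The vertices v₁, …, v₂ₖ are the elements 0, …, 2k-1 of Fin (k * 2).  For
-- i : Fin k the following have indices 2i and 2i + 1, so with i counted from 1
-- they are v₂ᵢ₋₁ and v₂ᵢ.
oddVertex evenVertex : ∀ {k} → Fin k → Fin (k ℕ.* 2)
oddVertex  i = combine i zero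
evenVertex i = combine i (suc zero)

OddVertex EvenVertex : ∀ k → Pred (Fin (k ℕ.* 2)) 0ℓ
OddVertex  k v = Σ (Fin k) λ i → v ≡ oddVertex i
EvenVertex k v = Σ (Fin k) λ i → v ≡ evenVertex i

------------------------------------------------------------------------
-- Blocks of coordinates

-- With coordinates counted from 0, block j consists of the nⱼ consecutive
-- coordinates from  start n j = Σ_{l < j} nₗ  on.  When counting from 1, the
-- number a_j is thus 1 + start n j.
start : ∀ {k} → (Fin k → ℕ) → Fin k → ℕ
start n zero    = 0
start n (suc j) = n zero ℕ.+ start (n ∘ suc) j

InBlock : ∀ {k s} → (Fin k → ℕ) → Fin k → Fin s → Set
InBlock n j i = start n j ℕ.≤ toℕ i × toℕ i ℕ.< start n j ℕ.+ n j

------------------------------------------------------------------------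
-- Ideals, quotients and regular sequences

module _ (R : RawRing c ℓ) where
  open RawRing R

  -- The least ideal containing G.
  data GeneratedIdeal (G : Pred Carrier g) : Pred Carrier (c ⊔ ℓ ⊔ g) where
    generator : ∀ {x} → G x → GeneratedIdeal G x
    0∈        : GeneratedIdeal G 0#
    +-closed  : ∀ {x y} → GeneratedIdeal G x → GeneratedIdeal G y →
                GeneratedIdeal G (x + y)
    *-closed  : ∀ r {x} → GeneratedIdeal G x → GeneratedIdeal G (r * x)
    ≈-closed  : ∀ {x y} → x ≈ y → GeneratedIdeal G x → GeneratedIdeal G y

  quotient : Pred Carrier g → RawRing c g
  quotient I = record
    { Carrier = Carrier
    ; _≈_     = λ x y → I (x + (- y))
    ; _+_     = _+_
    ; _*_     = _*_
    ; -_      = -_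
    ; 0#      = 0#
    ; 1#      = 1#
    }

  -- In positive form; in particular 0 counts as a zero divisor of every
  -- nonzero ring.
  NonZeroDivisor : Pred Carrier (c ⊔ ℓ)
  NonZeroDivisor x = ∀ y → x * y ≈ 0# → y ≈ 0#

module _ (R : RawRing c ℓ) where
  open RawRing R

  -- For the first element the quotient is by the ideal generated by the empty
  -- set, i.e. by the zero ideal.
  IsRegularSequence : ∀ {r} → Vector Carrier r → Set (c ⊔ ℓ)
  IsRegularSequence f = ∀ i →
    NonZeroDivisor
      (quotient R (GeneratedIdeal R λ h → ∃[ j ] j Fin.< i × h ≈ f j))
      (f i)

------------------------------------------------------------------------
-- Finite fields

record IsFiniteField (K : CommutativeRing c ℓ) (q : ℕ) : Set (c ⊔ ℓ) where
  open CommutativeRing K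
  field
    0≉1         : ¬ 0# ≈ 1#
    inverse     : ∀ x → ¬ x ≈ 0# → ∃[ y ] x * y ≈ 1#
    enumeration : Inverse (≡.setoid (Fin q)) setoid

------------------------------------------------------------------------
-- Polynomials

Monomial : ℕ → Set
Monomial s = Vec ℕ s

module _ (K : CommutativeRing c ℓ) where
  open CommutativeRing K
  open Powers (RawRing.rawSemiring rawRing) using (_^_; product)

  -- A polynomial is a formal sum of terms, in which a monomial may occur
  -- repeatedly or with coefficient zero; equality is equality of all
  -- coefficients (see polynomialRing).
  Poly : ℕ → Set c
  Poly s = List (Carrier × Monomial s)

  coeff : ∀ {s} → Poly s → Monomial s → Carrier
  coeff []            m = 0#
  coeff ((a , m′) ∷ p) m =
    (if does (Vec.≡-dec ℕ._≟_ m′ m) then a else 0#) + coeff p m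

  polynomialRing : ℕ → RawRing c ℓ
  polynomialRing s = record
    { Carrier = Poly s
    ; _≈_     = λ f h → ∀ m → coeff f m ≈ coeff h m
    ; _+_     = _++_
    ; _*_     = cartesianProductWith
                  λ (a , m) (b , m′) → a * b , zipWith ℕ._+_ m m′
    ; -_      = List.map λ (a , m) → - a , m
    ; 0#      = []
    ; 1#      = (1# , replicate s 0) ∷ []
    }

  X : ∀ {s} → Fin s → Poly s
  X {s} i = (1# , (replicate s 0 [ i ]≔ 1)) ∷ []

  evalMonomial : ∀ {s} → Monomial s → Vector Carrier s → Carrier
  evalMonomial m x = product λ i → x i ^ lookup m i

  eval : ∀ {s} → Poly s → Vector Carrier s → Carrier
  eval []            x = 0#
  eval ((a , m) ∷ p) x = a * evalMonomial m x + eval p x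

  Homogeneous : ∀ {s} → ℕ → Pred (Poly s) ℓ
  Homogeneous d f = ∀ m → Vec.sum m ≢ d → coeff f m ≈ 0#

------------------------------------------------------------------------
-- Projective space and vanishing ideals

module _ (K : CommutativeRing c ℓ) where
  open CommutativeRing K

  -- Homogeneous coordinates of a point of ℙˢ⁻¹; equality of points is _∼_.
  record ProjectivePoint (s : ℕ) : Set (c ⊔ ℓ) where
    field
      coord   : Vector Carrier s
      nonzero : ∃[ i ] ¬ coord i ≈ 0#

  open ProjectivePoint public

  _∼_ : ∀ {s} → Rel (ProjectivePoint s) (c ⊔ ℓ)
  P ∼ Q = ∃[ u ] ¬ u ≈ 0# × (∀ i → coord P i ≈ u * coord Q i)

  VanishingIdeal : ∀ {s} → Pred (ProjectivePoint s) g → Pred (Poly K s) (c ⊔ ℓ ⊔ g)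
  VanishingIdeal {s = s} Y = GeneratedIdeal (polynomialRing K s) λ f →
    (∃[ d ] Homogeneous K d f) × (∀ P → Y P → eval K f (coord P) ≈ 0#)

  IsCompleteIntersection : ∀ {s} → Pred (ProjectivePoint s) g → Set (c ⊔ ℓ ⊔ g)
  IsCompleteIntersection {s = s} Y = Σ (Vector (Poly K s) (s ∸ 1)) λ f →
    IsRegularSequence S f ×
    VanishingIdeal Y ≐ GeneratedIdeal S (λ h → ∃[ i ] h S.≈ f i)
    where
    S = polynomialRing K s
    module S = RawRing S

  -- The points [t₁,…,t₁,t₂,…,t₂,…,tₖ,…,tₖ] with all tⱼ nonzero and tⱼ repeated
  -- nⱼ times; it is meant for Σⱼ nⱼ = s, when every coordinate lies in exactly
  -- one block.
  𝕐 : ∀ {k} s → (Fin k → ℕ) → Pred (ProjectivePoint s) (c ⊔ ℓ)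
  𝕐 {k} s n P = Σ (Fin k → Carrier) λ t →
    (∀ j → ¬ t j ≈ 0#) ×
    (∃[ Q ] (∀ j i → InBlock n j i → coord Q i ≈ t j) × P ∼ Q)

------------------------------------------------------------------------
-- The generators

module _ (K : CommutativeRing c ℓ) (q s : ℕ) {k : ℕ} (n : Fin k → ℕ) where
  open RawRing (polynomialRing K s)
  open Powers rawSemiring using (_^_)

  -- Here a and o are the first coordinates of block j and of all blocks; they
  -- exist in Fin s when Σⱼ nⱼ = s and all nⱼ are positive.
  𝕎₀ : Pred (Poly K s) ℓ
  𝕎₀ f = Σ (Fin k) λ j → Σ (Fin s) λ a → Σ (Fin s) λ o →
    1 ℕ.≤ toℕ j × toℕ a ≡ start n j × toℕ o ≡ 0 ×
    f ≈ X K a ^ (q ∸ 1) + (- (X K o ^ (q ∸ 1)))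

  𝕎 : Fin k → Pred (Poly K s) ℓ
  𝕎 j f = Σ (Fin s) λ a → Σ (Fin s) λ i →
    toℕ a ≡ start n j × start n j ℕ.< toℕ i × toℕ i ℕ.< start n j ℕ.+ n j ×
    f ≈ X K i + (- X K a)

  generators : Pred (Poly K s) ℓ
  generators = 𝕎₀ ∪ λ f → ∃[ j ] 𝕎 j f

{-# OPTIONS --safe #-}
-- Number the coordinates from 0.  The generators are X_i^e - X_b^e, one for each
-- i > 0, with b < i and e ∈ {1 , q-1}: e = q-1 and b = 0 if i is the first
-- coordinate of its block, and otherwise e = 1 and b is that first coordinate.
-- They are triangular: the i-th one is monic in X_i over the polynomials in
-- X_0, …, X_(i-1), so division by it is linear over those polynomials and hence
-- preserves the ideal generated by its predecessors: the sequence is regular.  Modulo the generators every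
-- monomial equals one of the same degree with i-th exponent below e for all
-- i > 0.  If a homogeneous combination of such reduced monomials vanishes on 𝕐,
-- then setting X_0 = 1 gives a polynomial of degree less than q-1 in each
-- remaining block variable that vanishes on (K*)^(k-1), so it is zero.
module Submission where

open import Defs
open import Algebra.Bundles using (CommutativeRing; RawRing)
import Algebra.Definitions.RawSemiring as Powers
import Algebra.Properties.CommutativeMonoid.Sum as Sum
import Algebra.Properties.CommutativeSemigroup as CommutativeSemigroupProperties
import Algebra.Properties.Ring as RingProperties
import Algebra.Properties.Semiring.Exp as Exp
import Algebra.Properties.Semiring.Sum as SemiringSum
open import Data.Bool.Base using (if_then_else_; true; false)
open import Data.Fin.Base as Fin using (Fin; zero; suc; toℕ; fromℕ<; punchIn; punchOut; remQuot)
open import Data.Fin.Permutation using (Permutation; permutation; _⟨$⟩ʳ_)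
import Data.Fin.Properties as Fin
open import Data.List.Base as List using ([]; _∷_; _++_; length; filter; tabulate; cartesianProduct)
open import Data.List.Membership.Propositional using (lose)
open import Data.List.Membership.Propositional.Properties using (∈-allFin)
import Data.List.Properties as List
open import Data.List.Relation.Unary.All as All using (All; []; _∷_)
import Data.List.Relation.Unary.All.Properties as All
open import Data.Nat.Base as ℕ using (ℕ; zero; suc; NonZero; _∸_; _/_)
import Data.Nat.DivMod as ℕ
open import Data.Nat.Induction using (Acc; acc; <-wellFounded)
import Data.Nat.Properties as ℕ
open import Data.Product using (_×_; _,_; proj₁; proj₂; ∃-syntax)
open import Data.Sum.Base using (_⊎_; inj₁; inj₂)
open import Data.Vec.Base as Vec using ([]; _∷_; lookup; replicate; zipWith; _[_]≔_)
open import Data.Vec.Functional as Vector using (Vector)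
import Data.Vec.Properties as Vec
open import Function.Base using (_∘_; id)
open import Function.Bundles using (Inverse)
open import Relation.Binary.Definitions using (tri<; tri≈; tri>)
open import Relation.Binary.PropositionalEquality as ≡ using (_≡_; _≢_)
import Relation.Binary.Reasoning.Setoid as SetoidReasoning
open import Relation.Nullary.Decidable using (Dec; does; yes; no; ¬?; _×-dec_; dec-true; dec-false)
open import Relation.Nullary.Negation using (¬_; contradiction)
open import Relation.Unary using (Pred; Decidable; _≐_)

-- Division by a generator sends its product with `y` back to `y`; so if that product lies in the
-- ideal of the predecessors, then `y` does too, and this is regularity. The exponent `q-1` has two
-- origins. By Fermat both `X_i^(q-1)` and `X_0^(q-1)` equal 1 at a point with nonzero coordinates,
-- so their difference vanishes on `𝕐`. It is also the number of nonzero elements of `K`, so a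
-- polynomial of degree below `q-1` in each variable has too few coefficients to vanish on all of
-- them without being zero. The graph supplies two facts: the bipartition gives `∑ n ≡ s`, and the
-- matching makes every `n j` positive, so that every block has a first coordinate. The obstacle in
-- the encoding is that a polynomial is a list whose terms may repeat or cancel. Every construction
-- on lists must be shown to depend on the coefficients only; division and evaluation get this from
-- being linear extensions of maps on monomials.

infixl 6 _⊕_
_⊕_ : ∀ {s} → Monomial s → Monomial s → Monomial s
_⊕_ = zipWith ℕ._+_

𝟘 : ∀ {s} → Monomial s
𝟘 = replicate _ 0

⊕-comm : ∀ {s} (u v : Monomial s) → u ⊕ v ≡ v ⊕ u
⊕-comm = Vec.zipWith-comm ℕ.+-comm

⊕-assoc : ∀ {s} (u v w : Monomial s) → u ⊕ v ⊕ w ≡ u ⊕ (v ⊕ w)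
⊕-assoc = Vec.zipWith-assoc ℕ.+-assoc

⊕-identityˡ : ∀ {s} (u : Monomial s) → 𝟘 ⊕ u ≡ u
⊕-identityˡ = Vec.zipWith-identityˡ ℕ.+-identityˡ

_≟ₘ_ : ∀ {s} (u v : Monomial s) → Dec (u ≡ v)
_≟ₘ_ = Vec.≡-dec ℕ._≟_

-- Linear functionals on polynomials, and the polynomial ring.

module Polynomials {c ℓ} (K : CommutativeRing c ℓ) where
  open CommutativeRing K hiding (zero)
  open RingProperties ring using (-‿distribˡ-*; -0#≈0#; -‿+-comm; +-inverseˡ-unique; -‿involutive)
  open CommutativeSemigroupProperties +-commutativeSemigroup using () renaming (interchange to +-interchange)
  open CommutativeSemigroupProperties *-commutativeSemigroup using () renaming (x∙yz≈y∙xz to x*yz≈y*xz)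
  open SetoidReasoning setoid

  module _ {s : ℕ} where
    open RawRing (polynomialRing K s) public using () renaming
      (_≈_ to _≈ₚ_; _+_ to _+ₚ_; _*_ to _*ₚ_; -_ to -ₚ_; 0# to 0ₚ; 1# to 1ₚ)

  x-y≈0⇒x≈y : ∀ {x y} → x - y ≈ 0# → x ≈ y
  x-y≈0⇒x≈y {x} {y} eq = trans (+-inverseˡ-unique x (- y) eq) (-‿involutive y)

  δ : ∀ {s} → Monomial s → Monomial s → Carrier
  δ m u = if does (u ≟ₘ m) then 1# else 0#

  -- The K-linear extension of φ.  Two polynomials are equal exactly when all
  -- such functionals agree on them (coeff≈lin and lin-cong), which turns every
  -- identity between polynomials into one between monomials.
  lin : ∀ {s} → (Monomial s → Carrier) → Poly K s → Carrier
  lin φ []            = 0#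
  lin φ ((a , m) ∷ p) = a * φ m + lin φ p

  coeff≈lin : ∀ {s} (p : Poly K s) m → coeff K p m ≈ lin (δ m) p
  coeff≈lin []            m = refl
  coeff≈lin ((a , u) ∷ p) m = +-cong (lemma (does (u ≟ₘ m))) (coeff≈lin p m)
    where
    lemma : ∀ b → (if b then a else 0#) ≈ a * (if b then 1# else 0#)
    lemma true  = sym (*-identityʳ a)
    lemma false = sym (zeroʳ a)

  eval≈lin : ∀ {s} (p : Poly K s) x → eval K p x ≈ lin (λ m → evalMonomial K m x) p
  eval≈lin []            x = refl
  eval≈lin ((a , m) ∷ p) x = +-congˡ (eval≈lin p x)

  lin-ext : ∀ {s} {φ ψ : Monomial s → Carrier} → (∀ m → φ m ≈ ψ m) →
            ∀ p → lin φ p ≈ lin ψ p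
  lin-ext φ≈ψ []            = refl
  lin-ext φ≈ψ ((a , m) ∷ p) = +-cong (*-congˡ (φ≈ψ m)) (lin-ext φ≈ψ p)

  lin-++ : ∀ {s} (φ : Monomial s → Carrier) p q → lin φ (p ++ q) ≈ lin φ p + lin φ q
  lin-++ φ []            q = sym (+-identityˡ _)
  lin-++ φ ((a , m) ∷ p) q = trans (+-congˡ (lin-++ φ p q)) (sym (+-assoc _ _ _))

  lin-neg : ∀ {s} (φ : Monomial s → Carrier) p → lin φ (-ₚ p) ≈ - lin φ p
  lin-neg φ []            = sym -0#≈0#
  lin-neg φ ((a , m) ∷ p) =
    trans (+-cong (sym (-‿distribˡ-* a (φ m))) (lin-neg φ p)) (-‿+-comm _ _)

  lin-zero : ∀ {s} (p : Poly K s) → lin (λ _ → 0#) p ≈ 0#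
  lin-zero []            = refl
  lin-zero ((a , m) ∷ p) = trans (+-cong (zeroʳ a) (lin-zero p)) (+-identityˡ 0#)

  lin-+ : ∀ {s} (φ ψ : Monomial s → Carrier) p →
          lin (λ m → φ m + ψ m) p ≈ lin φ p + lin ψ p
  lin-+ φ ψ []            = sym (+-identityˡ 0#)
  lin-+ φ ψ ((a , m) ∷ p) =
    trans (+-cong (distribˡ a (φ m) (ψ m)) (lin-+ φ ψ p)) (+-interchange _ _ _ _)

  lin-* : ∀ {s} b (φ : Monomial s → Carrier) p →
          lin (λ m → b * φ m) p ≈ b * lin φ p
  lin-* b φ []            = sym (zeroʳ b)
  lin-* b φ ((a , m) ∷ p) =
    trans (+-cong (x*yz≈y*xz a b (φ m)) (lin-* b φ p)) (sym (distribˡ b _ _))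

  lin-swap : ∀ {s r} (ψ : Monomial s → Monomial r → Carrier) p q →
             lin (λ u → lin (ψ u) q) p ≈ lin (λ v → lin (λ u → ψ u v) p) q
  lin-swap ψ []            q = sym (lin-zero q)
  lin-swap ψ ((a , m) ∷ p) q = begin
    a * lin (ψ m) q + lin (λ u → lin (ψ u) q) p
      ≈⟨ +-cong (sym (lin-* a (ψ m) q)) (lin-swap ψ p q) ⟩
    lin (λ v → a * ψ m v) q + lin (λ v → lin (λ u → ψ u v) p) q
      ≈⟨ lin-+ _ _ q ⟨
    lin (λ v → a * ψ m v + lin (λ u → ψ u v) p) q ∎

  -- Multiplication by a single term `(a , u)` computes to `scale a (u ⊕_)`. A general `g` also
  -- covers substitutions of monomials such as `reduce`.
  scale : ∀ {s r} → Carrier → (Monomial s → Monomial r) → Poly K s → Poly K r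
  scale a g = List.map λ (b , v) → a * b , g v

  lin-scale : ∀ {s r} (φ : Monomial r → Carrier) a (g : Monomial s → Monomial r) p →
              lin φ (scale a g p) ≈ a * lin (φ ∘ g) p
  lin-scale φ a g []            = sym (zeroʳ a)
  lin-scale φ a g ((b , v) ∷ p) =
    trans (+-cong (*-assoc a b _) (lin-scale φ a g p)) (sym (distribˡ a _ _))

  -- The product is the bilinear extension of `_⊕_`. Through this lemma associativity, commutativity
  -- and unit laws become those of monomials under nested functionals, with `lin-swap` exchanging
  -- the two factors.
  lin-*ₚ : ∀ {s} (φ : Monomial s → Carrier) p q →
           lin φ (p *ₚ q) ≈ lin (λ u → lin (λ v → φ (u ⊕ v)) q) p
  lin-*ₚ φ []            q = refl
  lin-*ₚ φ ((a , u) ∷ p) q = begin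
    lin φ (scale a (u ⊕_) q ++ p *ₚ q)         ≈⟨ lin-++ φ (scale a (u ⊕_) q) (p *ₚ q) ⟩
    lin φ (scale a (u ⊕_) q) + lin φ (p *ₚ q)  ≈⟨ +-cong (lin-scale φ a (u ⊕_) q) (lin-*ₚ φ p q) ⟩
    a * lin (λ v → φ (u ⊕ v)) q + lin (λ u → lin (λ v → φ (u ⊕ v)) q) p ∎

  coeff-∉ : ∀ {s} {m : Monomial s} {p : Poly K s} → All (λ (_ , u) → u ≢ m) p → coeff K p m ≈ 0#
  coeff-∉ []                                            = refl
  coeff-∉ {m = m} {(a , u) ∷ p} (u≢m ∷ p≢m) rewrite dec-false (u ≟ₘ m) u≢m =
    trans (+-identityˡ _) (coeff-∉ p≢m)

  module _ {s π} {P : Pred (Monomial s) π} (P? : Decidable P) where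

    select : Poly K s → Poly K s
    select = List.filter (P? ∘ proj₂)

    select-all : ∀ p → All (P ∘ proj₂) (select p)
    select-all = All.all-filter (P? ∘ proj₂)

    coeff-select-∈ : ∀ p {m} → P m → coeff K (select p) m ≈ coeff K p m
    coeff-select-∈ []            Pm = refl
    coeff-select-∈ ((a , u) ∷ p) {m} Pm with P? u
    ... | yes _  = +-congˡ (coeff-select-∈ p Pm)
    ... | no ¬Pu rewrite dec-false (u ≟ₘ m) (λ { ≡.refl → ¬Pu Pm }) =
      trans (coeff-select-∈ p Pm) (sym (+-identityˡ _))

    coeff-select-∉ : ∀ p {m} → ¬ P m → coeff K (select p) m ≈ 0#
    coeff-select-∉ p ¬Pm = coeff-∉ (All.map (λ { Pu ≡.refl → ¬Pm Pu }) (select-all p))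

  delete : ∀ {s} → Monomial s → Poly K s → Poly K s
  delete m = select λ u → ¬? (u ≟ₘ m)

  -- All occurrences of `m` must be gathered at once: a hypothesis about coefficients bounds only
  -- their total, never a single term of the list.
  lin-delete : ∀ {s} (φ : Monomial s → Carrier) m p →
               lin φ p ≈ coeff K p m * φ m + lin φ (delete m p)
  lin-delete φ m [] = sym (trans (+-identityʳ _) (zeroˡ _))
  lin-delete φ m ((a , u) ∷ p) with u ≟ₘ m
  ... | yes ≡.refl = begin
    a * φ u + lin φ p                                      ≈⟨ +-congˡ (lin-delete φ u p) ⟩
    a * φ u + (coeff K p u * φ u + lin φ (delete u p))     ≈⟨ +-assoc _ _ _ ⟨
    a * φ u + coeff K p u * φ u + lin φ (delete u p)       ≈⟨ +-congʳ (distribʳ _ _ _) ⟨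
    (a + coeff K p u) * φ u + lin φ (delete u p)           ∎
  ... | no _ = begin
    a * φ u + lin φ p                                      ≈⟨ +-congˡ (lin-delete φ m p) ⟩
    a * φ u + (coeff K p m * φ m + lin φ (delete m p))     ≈⟨ x∙yz≈y∙xz _ _ _ ⟩
    coeff K p m * φ m + (a * φ u + lin φ (delete m p))     ≈⟨ +-congʳ (*-congʳ (+-identityˡ _)) ⟨
    (0# + coeff K p m) * φ m + (a * φ u + lin φ (delete m p)) ∎
    where open CommutativeSemigroupProperties +-commutativeSemigroup using (x∙yz≈y∙xz)

  -- Deleting every occurrence of the leading monomial also removes terms deep in the list, so the
  -- recursion runs on a bound for the length instead of on the list.
  lin≈0 : ∀ {s} (φ : Monomial s → Carrier) n p → length p ℕ.≤ n →
          p ≈ₚ 0ₚ → lin φ p ≈ 0#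
  lin≈0 φ n       []                _         p≈0 = refl
  lin≈0 φ (suc n) p@((a , m) ∷ p′) (ℕ.s≤s l) p≈0 = begin
    lin φ p                                  ≈⟨ lin-delete φ m p ⟩
    coeff K p m * φ m + lin φ (delete m p)   ≈⟨ +-cong (trans (*-congʳ (p≈0 m)) (zeroˡ _)) lin-rest ⟩
    0# + 0#                                  ≈⟨ +-identityˡ 0# ⟩
    0#                                       ∎
    where
    rest≈0 : delete m p ≈ₚ 0ₚ
    rest≈0 u with m ≟ₘ u
    ... | yes ≡.refl = coeff-select-∉ (λ u → ¬? (u ≟ₘ m)) p λ m≢m → m≢m ≡.refl
    ... | no  m≢u    = trans (coeff-select-∈ (λ u → ¬? (u ≟ₘ m)) p (m≢u ∘ ≡.sym)) (p≈0 u)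
    shorter : length (delete m p) ℕ.≤ n
    shorter rewrite dec-true (m ≟ₘ m) ≡.refl = ℕ.≤-trans (List.length-filter _ p′) l
    lin-rest = lin≈0 φ n (delete m p) shorter rest≈0

  -- A record, unlike ≈ₚ itself, lets both polynomials be inferred.
  infix 4 _≋_
  record _≋_ {s} (p q : Poly K s) : Set ℓ where
    constructor ≈ₚ⇒≋
    field ≋⇒≈ₚ : p ≈ₚ q
  open _≋_ public

  lin-cong : ∀ {s} (φ : Monomial s → Carrier) {p q} → p ≋ q → lin φ p ≈ lin φ q
  lin-cong φ {p} {q} (≈ₚ⇒≋ p≈q) = x-y≈0⇒x≈y (begin
    lin φ p + - lin φ q     ≈⟨ +-congˡ (lin-neg φ q) ⟨
    lin φ p + lin φ (-ₚ q)  ≈⟨ lin-++ φ p (-ₚ q) ⟨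
    lin φ (p ++ -ₚ q)       ≈⟨ lin≈0 φ _ (p ++ -ₚ q) ℕ.≤-refl difference ⟩
    0#                      ∎)
    where
    difference : p ++ -ₚ q ≈ₚ 0ₚ
    difference m = begin
      coeff K (p ++ -ₚ q) m             ≈⟨ coeff≈lin (p ++ -ₚ q) m ⟩
      lin (δ m) (p ++ -ₚ q)             ≈⟨ lin-++ (δ m) p (-ₚ q) ⟩
      lin (δ m) p + lin (δ m) (-ₚ q)    ≈⟨ +-congˡ (lin-neg (δ m) q) ⟩
      lin (δ m) p + - lin (δ m) q       ≈⟨ +-cong (coeff≈lin p m) (-‿cong (coeff≈lin q m)) ⟨
      coeff K p m + - coeff K q m       ≈⟨ +-congʳ (p≈q m) ⟩
      coeff K q m + - coeff K q m       ≈⟨ -‿inverseʳ _ ⟩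
      0#                                ∎

  ≋-from-lin : ∀ {s} {p q : Poly K s} → (∀ φ → lin φ p ≈ lin φ q) → p ≋ q
  ≋-from-lin {p = p} {q} eq = ≈ₚ⇒≋ λ m → begin
    coeff K p m  ≈⟨ coeff≈lin p m ⟩
    lin (δ m) p  ≈⟨ eq (δ m) ⟩
    lin (δ m) q  ≈⟨ coeff≈lin q m ⟨
    coeff K q m  ∎

  ≡⇒φ : ∀ {s} (φ : Monomial s → Carrier) {u v} → u ≡ v → φ u ≈ φ v
  ≡⇒φ φ ≡.refl = refl

  +ₚ-cong : ∀ {s} {p p′ q q′ : Poly K s} → p ≋ p′ → q ≋ q′ → p +ₚ q ≋ p′ +ₚ q′
  +ₚ-cong {p = p} {p′} {q} {q′} p≈p′ q≈q′ = ≋-from-lin λ φ → begin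
    lin φ (p ++ q)        ≈⟨ lin-++ φ p q ⟩
    lin φ p + lin φ q     ≈⟨ +-cong (lin-cong φ {p} {p′} p≈p′) (lin-cong φ {q} {q′} q≈q′) ⟩
    lin φ p′ + lin φ q′   ≈⟨ lin-++ φ p′ q′ ⟨
    lin φ (p′ ++ q′)      ∎

  *ₚ-cong : ∀ {s} {p p′ q q′ : Poly K s} → p ≋ p′ → q ≋ q′ → p *ₚ q ≋ p′ *ₚ q′
  *ₚ-cong {p = p} {p′} {q} {q′} p≈p′ q≈q′ = ≋-from-lin λ φ → begin
    lin φ (p *ₚ q)                            ≈⟨ lin-*ₚ φ p q ⟩
    lin (λ u → lin (λ v → φ (u ⊕ v)) q) p     ≈⟨ lin-ext (λ u → lin-cong (λ v → φ (u ⊕ v)) {q} {q′} q≈q′) p ⟩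
    lin (λ u → lin (λ v → φ (u ⊕ v)) q′) p    ≈⟨ lin-cong _ {p} {p′} p≈p′ ⟩
    lin (λ u → lin (λ v → φ (u ⊕ v)) q′) p′   ≈⟨ lin-*ₚ φ p′ q′ ⟨
    lin φ (p′ *ₚ q′)                          ∎

  *ₚ-comm : ∀ {s} (p q : Poly K s) → p *ₚ q ≋ q *ₚ p
  *ₚ-comm p q = ≋-from-lin λ φ → begin
    lin φ (p *ₚ q)                          ≈⟨ lin-*ₚ φ p q ⟩
    lin (λ u → lin (λ v → φ (u ⊕ v)) q) p   ≈⟨ lin-swap (λ u v → φ (u ⊕ v)) p q ⟩
    lin (λ v → lin (λ u → φ (u ⊕ v)) p) q   ≈⟨ lin-ext (λ v → lin-ext (λ u → ≡⇒φ φ (⊕-comm u v)) p) q ⟩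
    lin (λ v → lin (λ u → φ (v ⊕ u)) p) q   ≈⟨ lin-*ₚ φ q p ⟨
    lin φ (q *ₚ p)                          ∎

  *ₚ-assoc : ∀ {s} (p q r : Poly K s) → p *ₚ q *ₚ r ≋ p *ₚ (q *ₚ r)
  *ₚ-assoc p q r = ≋-from-lin λ φ → begin
    lin φ (p *ₚ q *ₚ r)
      ≈⟨ lin-*ₚ φ (p *ₚ q) r ⟩
    lin (λ u → lin (λ w → φ (u ⊕ w)) r) (p *ₚ q)
      ≈⟨ lin-*ₚ _ p q ⟩
    lin (λ u → lin (λ v → lin (λ w → φ (u ⊕ v ⊕ w)) r) q) p
      ≈⟨ lin-ext (λ u → lin-ext (λ v → lin-ext (λ w → ≡⇒φ φ (⊕-assoc u v w)) r) q) p ⟩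
    lin (λ u → lin (λ v → lin (λ w → φ (u ⊕ (v ⊕ w))) r) q) p
      ≈⟨ lin-ext (λ u → lin-*ₚ (λ v → φ (u ⊕ v)) q r) p ⟨
    lin (λ u → lin (λ v → φ (u ⊕ v)) (q *ₚ r)) p
      ≈⟨ lin-*ₚ φ p (q *ₚ r) ⟨
    lin φ (p *ₚ (q *ₚ r)) ∎

  *ₚ-identityˡ : ∀ {s} (p : Poly K s) → 1ₚ *ₚ p ≋ p
  *ₚ-identityˡ p = ≋-from-lin λ φ → begin
    lin φ (1ₚ *ₚ p)                          ≈⟨ lin-*ₚ φ 1ₚ p ⟩
    1# * lin (λ v → φ (𝟘 ⊕ v)) p + 0#        ≈⟨ +-identityʳ _ ⟩
    1# * lin (λ v → φ (𝟘 ⊕ v)) p             ≈⟨ *-identityˡ _ ⟩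
    lin (λ v → φ (𝟘 ⊕ v)) p                  ≈⟨ lin-ext (λ v → ≡⇒φ φ (⊕-identityˡ v)) p ⟩
    lin φ p                                  ∎

  *ₚ-distribʳ : ∀ {s} (r p q : Poly K s) → (p +ₚ q) *ₚ r ≋ p *ₚ r +ₚ q *ₚ r
  *ₚ-distribʳ r p q = ≋-from-lin λ φ → begin
    lin φ ((p ++ q) *ₚ r)                   ≈⟨ lin-*ₚ φ (p ++ q) r ⟩
    lin (λ u → lin (λ v → φ (u ⊕ v)) r) (p ++ q)  ≈⟨ lin-++ _ p q ⟩
    lin (λ u → lin (λ v → φ (u ⊕ v)) r) p + lin (λ u → lin (λ v → φ (u ⊕ v)) r) q
      ≈⟨ +-cong (lin-*ₚ φ p r) (lin-*ₚ φ q r) ⟨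
    lin φ (p *ₚ r) + lin φ (q *ₚ r)         ≈⟨ lin-++ φ (p *ₚ r) (q *ₚ r) ⟨
    lin φ (p *ₚ r ++ q *ₚ r)                ∎

  +ₚ-comm : ∀ {s} (p q : Poly K s) → p +ₚ q ≋ q +ₚ p
  +ₚ-comm p q = ≋-from-lin λ φ →
    trans (lin-++ φ p q) (trans (+-comm _ _) (sym (lin-++ φ q p)))

  -ₚ-inverseˡ : ∀ {s} (p : Poly K s) → -ₚ p +ₚ p ≋ 0ₚ
  -ₚ-inverseˡ p = ≋-from-lin λ φ →
    trans (lin-++ φ (-ₚ p) p) (trans (+-congʳ (lin-neg φ p)) (-‿inverseˡ _))

  -ₚ-cong : ∀ {s} {p q : Poly K s} → p ≋ q → -ₚ p ≋ -ₚ q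
  -ₚ-cong {p = p} {q} p≈q = ≋-from-lin λ φ →
    trans (lin-neg φ p) (trans (-‿cong (lin-cong φ p≈q)) (sym (lin-neg φ q)))

  ≋-refl : ∀ {s} {p : Poly K s} → p ≋ p
  ≋-refl = ≋-from-lin λ φ → refl

  ≋-sym : ∀ {s} {p q : Poly K s} → p ≋ q → q ≋ p
  ≋-sym (≈ₚ⇒≋ p≈q) = ≈ₚ⇒≋ λ m → sym (p≈q m)

  ≋-trans : ∀ {s} {p q r : Poly K s} → p ≋ q → q ≋ r → p ≋ r
  ≋-trans (≈ₚ⇒≋ p≈q) (≈ₚ⇒≋ q≈r) = ≈ₚ⇒≋ λ m → trans (p≈q m) (q≈r m)

  ≋-reflexive : ∀ {s} {p q : Poly K s} → p ≡ q → p ≋ q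
  ≋-reflexive ≡.refl = ≋-refl

  polynomialCommutativeRing : ℕ → CommutativeRing c ℓ
  polynomialCommutativeRing s = record
    { Carrier = Poly K s
    ; _≈_     = _≋_
    ; _+_     = _+ₚ_
    ; _*_     = _*ₚ_
    ; -_      = -ₚ_
    ; 0#      = 0ₚ
    ; 1#      = 1ₚ
    ; isCommutativeRing = record
      { isRing = record
        { +-isAbelianGroup = record
          { isGroup = record
            { isMonoid = record
              { isSemigroup = record
                { isMagma = record
                  { isEquivalence = record { refl = ≋-refl ; sym = ≋-sym ; trans = ≋-trans }
                  ; ∙-cong        = +ₚ-cong
                  }
                ; assoc = λ p q r → ≋-reflexive (List.++-assoc p q r)
                }
              ; identity = (λ p → ≋-refl) , λ p → ≋-reflexive (List.++-identityʳ p)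
              }
            ; inverse = -ₚ-inverseˡ , λ p → ≋-trans (+ₚ-comm p (-ₚ p)) (-ₚ-inverseˡ p)
            ; ⁻¹-cong = -ₚ-cong
            }
          ; comm = +ₚ-comm
          }
        ; *-cong     = *ₚ-cong
        ; *-assoc    = *ₚ-assoc
        ; *-identity = *ₚ-identityˡ , λ p → ≋-trans (*ₚ-comm p 1ₚ) (*ₚ-identityˡ p)
        ; distrib    = (λ r p q → ≋-trans (*ₚ-comm r (p +ₚ q))
                         (≋-trans (*ₚ-distribʳ r p q) (+ₚ-cong (*ₚ-comm p r) (*ₚ-comm q r))))
                     , *ₚ-distribʳ
        }
      ; *-comm = *ₚ-comm
      }
    }

-- Subtraction, degree and weight of monomials.

infixl 6 _⊖_
_⊖_ : ∀ {s} → Monomial s → Monomial s → Monomial s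
_⊖_ = zipWith _∸_

power : ∀ {s} → Fin s → ℕ → Monomial s
power i e = 𝟘 [ i ]≔ e

⊕-identityʳ : ∀ {s} (u : Monomial s) → u ⊕ 𝟘 ≡ u
⊕-identityʳ = Vec.zipWith-identityʳ ℕ.+-identityʳ

⊖-identityʳ : ∀ {s} (u : Monomial s) → u ⊖ 𝟘 ≡ u
⊖-identityʳ []      = ≡.refl
⊖-identityʳ (m ∷ u) = ≡.cong (m ∷_) (⊖-identityʳ u)

⊕-⊖-cancel : ∀ {s} (u v : Monomial s) → u ⊕ v ⊖ v ≡ u
⊕-⊖-cancel []      []      = ≡.refl
⊕-⊖-cancel (m ∷ u) (n ∷ v) = ≡.cong₂ _∷_ (ℕ.m+n∸n≡m m n) (⊕-⊖-cancel u v)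

-- Subtraction is truncated, but at coordinate `i` both sides truncate the same exponent, because
-- `u` adds nothing there.
⊕-⊖-power : ∀ {s} (m u : Monomial s) i e → lookup u i ≡ 0 →
            m ⊕ u ⊖ power i e ≡ (m ⊖ power i e) ⊕ u
⊕-⊖-power (m ∷ ms) (.0 ∷ us) zero e ≡.refl = ≡.cong₂ _∷_
  (≡.trans (≡.cong (_∸ e) (ℕ.+-identityʳ m)) (≡.sym (ℕ.+-identityʳ (m ∸ e))))
  (≡.trans (⊖-identityʳ _) (≡.cong (_⊕ us) (≡.sym (⊖-identityʳ ms))))
⊕-⊖-power (m ∷ ms) (u ∷ us) (suc i) e eq = ≡.cong (m ℕ.+ u ∷_) (⊕-⊖-power ms us i e eq)

⊖-⊕-power : ∀ {s} (m : Monomial s) i {e} → e ℕ.≤ lookup m i → (m ⊖ power i e) ⊕ power i e ≡ m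
⊖-⊕-power (m ∷ ms) zero    e≤ = ≡.cong₂ _∷_ (ℕ.m∸n+n≡m e≤)
  (≡.trans (⊕-identityʳ _) (⊖-identityʳ ms))
⊖-⊕-power (m ∷ ms) (suc i) e≤ = ≡.cong₂ _∷_ (ℕ.+-identityʳ m) (⊖-⊕-power ms i e≤)

lookup-power : ∀ {s} (i : Fin s) e → lookup (power i e) i ≡ e
lookup-power i e = Vec.lookup∘update i 𝟘 e

lookup-power-≢ : ∀ {s} {i j : Fin s} e → i ≢ j → lookup (power j e) i ≡ 0
lookup-power-≢ {i = i} e i≢j = ≡.trans (Vec.lookup∘update′ i≢j 𝟘 e) (Vec.lookup-replicate i 0)

sum-⊕ : ∀ {s} (u v : Monomial s) → Vec.sum (u ⊕ v) ≡ Vec.sum u ℕ.+ Vec.sum v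
sum-⊕ []      []      = ≡.refl
sum-⊕ (m ∷ u) (n ∷ v) = ≡.trans (≡.cong (m ℕ.+ n ℕ.+_) (sum-⊕ u v)) (interchange m n _ _)
  where open CommutativeSemigroupProperties ℕ.+-commutativeSemigroup using (interchange)

sum-𝟘 : ∀ s → Vec.sum (𝟘 {s}) ≡ 0
sum-𝟘 zero    = ≡.refl
sum-𝟘 (suc s) = sum-𝟘 s

sum-power : ∀ {s} (i : Fin s) e → Vec.sum (power i e) ≡ e
sum-power {suc s} zero    e = ≡.trans (≡.cong (e ℕ.+_) (sum-𝟘 s)) (ℕ.+-identityʳ e)
sum-power         (suc i) e = sum-power i e

-- Σᵢ i mᵢ, with coordinates counted from 0.
weight : ∀ {s} → Monomial s → ℕ
weight []      = 0
weight (_ ∷ u) = Vec.sum u ℕ.+ weight u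

weight-⊕ : ∀ {s} (u v : Monomial s) → weight (u ⊕ v) ≡ weight u ℕ.+ weight v
weight-⊕ []      []      = ≡.refl
weight-⊕ (_ ∷ u) (_ ∷ v) =
  ≡.trans (≡.cong₂ ℕ._+_ (sum-⊕ u v) (weight-⊕ u v)) (interchange (Vec.sum u) _ _ _)
  where open CommutativeSemigroupProperties ℕ.+-commutativeSemigroup using (interchange)

weight-𝟘 : ∀ s → weight (𝟘 {s}) ≡ 0
weight-𝟘 zero    = ≡.refl
weight-𝟘 (suc s) = ≡.cong₂ ℕ._+_ (sum-𝟘 s) (weight-𝟘 s)

weight-power : ∀ {s} (i : Fin s) e → weight (power i e) ≡ toℕ i ℕ.* e
weight-power {suc s} zero    e = weight-𝟘 (suc s)
weight-power         (suc i) e = ≡.cong₂ ℕ._+_ (sum-power i e) (weight-power i e)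

sum-⊕-power : ∀ {s} (m : Monomial s) {i j} e → Vec.sum (m ⊕ power i e) ≡ Vec.sum (m ⊕ power j e)
sum-⊕-power m {i} {j} e = begin
  Vec.sum (m ⊕ power i e)                 ≡⟨ sum-⊕ m (power i e) ⟩
  Vec.sum m ℕ.+ Vec.sum (power i e)       ≡⟨ ≡.cong (Vec.sum m ℕ.+_) (≡.trans (sum-power i e) (≡.sym (sum-power j e))) ⟩
  Vec.sum m ℕ.+ Vec.sum (power j e)       ≡⟨ sum-⊕ m (power j e) ⟨
  Vec.sum (m ⊕ power j e)                 ∎
  where open ≡.≡-Reasoning

weight-⊕-power : ∀ {s} (m : Monomial s) {i j} e .{{_ : NonZero e}} → toℕ i ℕ.< toℕ j →
                 weight (m ⊕ power i e) ℕ.< weight (m ⊕ power j e)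
weight-⊕-power m {i} {j} e i<j = begin-strict
  weight (m ⊕ power i e)              ≡⟨ weight-⊕ m (power i e) ⟩
  weight m ℕ.+ weight (power i e)     ≡⟨ ≡.cong (weight m ℕ.+_) (weight-power i e) ⟩
  weight m ℕ.+ toℕ i ℕ.* e            <⟨ ℕ.+-monoʳ-< (weight m) (ℕ.*-monoˡ-< e i<j) ⟩
  weight m ℕ.+ toℕ j ℕ.* e            ≡⟨ ≡.cong (weight m ℕ.+_) (weight-power j e) ⟨
  weight m ℕ.+ weight (power j e)     ≡⟨ weight-⊕ m (power j e) ⟨
  weight (m ⊕ power j e)              ∎
  where open ℕ.≤-Reasoning

-- Evaluation, ideals, and division by binomials.

module Binomials {c ℓ} (K : CommutativeRing c ℓ) where
  open CommutativeRing K hiding (zero)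
  open Polynomials K
  open RingProperties ring using (-1*x≈-x)
  open CommutativeSemigroupProperties *-commutativeSemigroup using () renaming (interchange to *-interchange)
  open Exp semiring using (_^_; ^-congˡ; ^-homo-*)
  open SetoidReasoning setoid

  evalMonomial-⊕ : ∀ {s} (u v : Monomial s) x →
                   evalMonomial K (u ⊕ v) x ≈ evalMonomial K u x * evalMonomial K v x
  evalMonomial-⊕ []      []      x = sym (*-identityˡ 1#)
  evalMonomial-⊕ (m ∷ u) (n ∷ v) x =
    trans (*-cong (^-homo-* (x zero) m n) (evalMonomial-⊕ u v (x ∘ suc))) (*-interchange _ _ _ _)

  evalMonomial-𝟘 : ∀ {s} (x : Vector Carrier s) → evalMonomial K 𝟘 x ≈ 1#
  evalMonomial-𝟘 {zero}  x = refl
  evalMonomial-𝟘 {suc s} x = trans (*-identityˡ _) (evalMonomial-𝟘 (x ∘ suc))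

  evalMonomial-power : ∀ {s} (i : Fin s) e x → evalMonomial K (power i e) x ≈ x i ^ e
  evalMonomial-power zero    e x = trans (*-congˡ (evalMonomial-𝟘 (x ∘ suc))) (*-identityʳ _)
  evalMonomial-power (suc i) e x = trans (*-identityˡ _) (evalMonomial-power i e (x ∘ suc))

  -- The first alternative is for reduced monomials, which do not involve the coordinates that are
  -- not first in their block.
  evalMonomial-cong : ∀ {s} (m : Monomial s) {x y} → (∀ i → lookup m i ≡ 0 ⊎ x i ≈ y i) →
                      evalMonomial K m x ≈ evalMonomial K m y
  evalMonomial-cong []      eq = refl
  evalMonomial-cong (n ∷ m) {x} {y} eq = *-cong (head (eq zero)) (evalMonomial-cong m (eq ∘ suc))
    where
    head : n ≡ 0 ⊎ x zero ≈ y zero → x zero ^ n ≈ y zero ^ n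
    head (inj₁ ≡.refl) = refl
    head (inj₂ x₀≈y₀)  = ^-congˡ n x₀≈y₀

  eval-cong : ∀ {s} {p q : Poly K s} x → p ≋ q → eval K p x ≈ eval K q x
  eval-cong {p = p} {q} x p≋q =
    trans (eval≈lin p x) (trans (lin-cong _ p≋q) (sym (eval≈lin q x)))

  eval-++ : ∀ {s} (p q : Poly K s) x → eval K (p ++ q) x ≈ eval K p x + eval K q x
  eval-++ p q x = trans (eval≈lin (p ++ q) x)
    (trans (lin-++ _ p q) (sym (+-cong (eval≈lin p x) (eval≈lin q x))))

  eval-*ₚ : ∀ {s} (p q : Poly K s) x → eval K (p *ₚ q) x ≈ eval K p x * eval K q x
  eval-*ₚ p q x = begin
    eval K (p *ₚ q) x                           ≈⟨ eval≈lin (p *ₚ q) x ⟩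
    lin φ (p *ₚ q)                              ≈⟨ lin-*ₚ φ p q ⟩
    lin (λ u → lin (λ v → φ (u ⊕ v)) q) p       ≈⟨ lin-ext (λ u → lin-ext (λ v → evalMonomial-⊕ u v x) q) p ⟩
    lin (λ u → lin (λ v → φ u * φ v) q) p       ≈⟨ lin-ext (λ u → trans (lin-* (φ u) φ q) (*-comm _ _)) p ⟩
    lin (λ u → lin φ q * φ u) p                 ≈⟨ lin-* (lin φ q) φ p ⟩
    lin φ q * lin φ p                           ≈⟨ *-comm _ _ ⟩
    lin φ p * lin φ q                           ≈⟨ *-cong (eval≈lin p x) (eval≈lin q x) ⟨
    eval K p x * eval K q x                     ∎
    where φ = λ m → evalMonomial K m x

  Ideal : ∀ {s g} → Pred (Poly K s) g → Pred (Poly K s) _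
  Ideal = GeneratedIdeal (polynomialRing K _)

  eval-ideal : ∀ {s g} {G : Pred (Poly K s) g} x → (∀ {h} → G h → eval K h x ≈ 0#) →
               ∀ {h} → Ideal G h → eval K h x ≈ 0#
  eval-ideal x G⇒0 (generator h∈G)              = G⇒0 h∈G
  eval-ideal x G⇒0 0∈                           = refl
  eval-ideal x G⇒0 (+-closed {p} {q} p∈ q∈)     = trans (eval-++ p q x)
    (trans (+-cong (eval-ideal x G⇒0 p∈) (eval-ideal x G⇒0 q∈)) (+-identityˡ 0#))
  eval-ideal x G⇒0 (*-closed r {p} p∈)          = trans (eval-*ₚ r p x)
    (trans (*-congˡ (eval-ideal x G⇒0 p∈)) (zeroʳ _))
  eval-ideal x G⇒0 (≈-closed {p} {q} p≈q p∈)    =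
    trans (sym (eval-cong {p = p} {q} x (≈ₚ⇒≋ p≈q))) (eval-ideal x G⇒0 p∈)

  ≋-closed : ∀ {s g} {G : Pred (Poly K s) g} {p q} → p ≋ q → Ideal G p → Ideal G q
  ≋-closed p≋q = ≈-closed (≋⇒≈ₚ p≋q)

  generated⊆ : ∀ {s g h} {G : Pred (Poly K s) g} {H : Pred (Poly K s) h} →
               (∀ {p} → G p → Ideal H p) → ∀ {p} → Ideal G p → Ideal H p
  generated⊆ G⊆H (generator p∈)    = G⊆H p∈
  generated⊆ G⊆H 0∈                = 0∈
  generated⊆ G⊆H (+-closed p∈ q∈)  = +-closed (generated⊆ G⊆H p∈) (generated⊆ G⊆H q∈)
  generated⊆ G⊆H (*-closed r p∈)   = *-closed r (generated⊆ G⊆H p∈)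
  generated⊆ G⊆H (≈-closed p≈q p∈) = ≈-closed p≈q (generated⊆ G⊆H p∈)

  term : ∀ {s} → Carrier → Monomial s → Poly K s
  term a m = (a , m) ∷ []

  -- In this form `X K i +ₚ -ₚ X K b` computes to `binomial (power i 1) (power b 1)`, which is why
  -- `f-other` needs only `refl`.
  binomial : ∀ {s} → Monomial s → Monomial s → Poly K s
  binomial u v = (1# , u) ∷ (- 1# , v) ∷ []

  lin-binomial : ∀ {s} (φ : Monomial s → Carrier) u v → lin φ (binomial u v) ≈ φ u - φ v
  lin-binomial φ u v = +-cong (*-identityˡ _) (trans (+-identityʳ _) (-1*x≈-x _))

  lin-*ₚ-binomial : ∀ {s} (φ : Monomial s → Carrier) p u v →
                    lin φ (p *ₚ binomial u v) ≈ lin (λ m → φ (m ⊕ u) - φ (m ⊕ v)) p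
  lin-*ₚ-binomial φ p u v =
    trans (lin-*ₚ φ p (binomial u v)) (lin-ext (λ m → lin-binomial (λ w → φ (m ⊕ w)) u v) p)

  lin-- : ∀ {s} (φ ψ : Monomial s → Carrier) p → lin (λ m → φ m - ψ m) p ≈ lin φ p - lin ψ p
  lin-- φ ψ p = begin
    lin (λ m → φ m - ψ m) p                ≈⟨ lin-+ φ (λ m → - ψ m) p ⟩
    lin φ p + lin (λ m → - ψ m) p          ≈⟨ +-congˡ (lin-ext (λ m → sym (-1*x≈-x (ψ m))) p) ⟩
    lin φ p + lin (λ m → - 1# * ψ m) p     ≈⟨ +-congˡ (trans (lin-* (- 1#) ψ p) (-1*x≈-x _)) ⟩
    lin φ p - lin ψ p                      ∎

  eval-binomial : ∀ {s} (u v : Monomial s) x →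
                  eval K (binomial u v) x ≈ evalMonomial K u x - evalMonomial K v x
  eval-binomial u v x = trans (eval≈lin (binomial u v) x) (lin-binomial _ u v)

  module _ {s : ℕ} where
    open Powers (RawRing.rawSemiring (polynomialRing K s)) public using () renaming (_^_ to _^ₚ_)

  X^≋term : ∀ {s} (i : Fin s) n → X K i ^ₚ n ≋ term 1# (power i n)
  X^≋term {s} i zero = ≋-reflexive (≡.cong (λ m → term 1# m) (≡.sym (lemma i)))
    where
    lemma : ∀ {s} (i : Fin s) → power i 0 ≡ 𝟘
    lemma zero    = ≡.refl
    lemma (suc i) = ≡.cong (0 ∷_) (lemma i)
  X^≋term {s} i (suc n) = ≋-trans (*ₚ-cong (≋-refl {p = X K i}) (X^≋term i n)) (≋-from-lin λ φ →
    +-congʳ (*-cong (*-identityˡ 1#) (≡⇒φ φ (lemma i n))))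
    where
    lemma : ∀ {s} (i : Fin s) n → power i 1 ⊕ power i n ≡ power i (suc n)
    lemma zero    n = ≡.cong (suc n ∷_) (⊕-identityˡ 𝟘)
    lemma (suc i) n = ≡.cong (0 ∷_) (lemma i n)

  X^-X^≋binomial : ∀ {s} (i j : Fin s) n →
    X K i ^ₚ n +ₚ -ₚ (X K j ^ₚ n) ≋ binomial (power i n) (power j n)
  X^-X^≋binomial i j n = +ₚ-cong (X^≋term i n) (-ₚ-cong (X^≋term j n))

  -- Division by X_i^e - X_b^e with respect to X_i: the quotient is linear over
  -- the polynomials free of X_i, so it preserves ideals generated by such
  -- polynomials.
  module Division {s} (i b : Fin s) (b≢i : b ≢ i) (e : ℕ) .{{_ : NonZero e}} where

    -- X^m = (X_i^e - X_b^e) * monomialQuotient t m + a monomial, provided that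
    -- t e ≤ m_i.
    monomialQuotient : ℕ → Monomial s → Poly K s
    monomialQuotient zero    m = []
    monomialQuotient (suc t) m =
      (1# , m ⊖ power i e) ∷ scale 1# (_⊕ power b e) (monomialQuotient t (m ⊖ power i e))

    -- The largest admissible number of steps, so that the remainder has degree below `e` in `X_i`.
    -- The quotient is a finite geometric sum: each further term trades one more `X_i^e` for
    -- `X_b^e`.
    divided : Monomial s → Poly K s
    divided m = monomialQuotient (lookup m i / e) m

    divide : Poly K s → Poly K s
    divide []            = []
    divide ((a , m) ∷ p) = scale a id (divided m) ++ divide p

    lin-divide : ∀ φ p → lin φ (divide p) ≈ lin (λ m → lin φ (divided m)) p
    lin-divide φ []            = refl
    lin-divide φ ((a , m) ∷ p) = trans (lin-++ φ (scale a id (divided m)) (divide p))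
      (+-cong (lin-scale φ a id (divided m)) (lin-divide φ p))

    lin-monomialQuotient : ∀ φ t m → lin φ (monomialQuotient (suc t) m) ≈
      φ (m ⊖ power i e) + lin (λ w → φ (w ⊕ power b e)) (monomialQuotient t (m ⊖ power i e))
    lin-monomialQuotient φ t m =
      +-cong (*-identityˡ _) (trans (lin-scale φ 1# _ (monomialQuotient t (m ⊖ power i e))) (*-identityˡ _))

    monomialQuotient-⊕ : ∀ φ t m {u} → lookup u i ≡ 0 →
      lin φ (monomialQuotient t (m ⊕ u)) ≈ lin (λ w → φ (w ⊕ u)) (monomialQuotient t m)
    monomialQuotient-⊕ φ zero    m uᵢ≡0 = refl
    monomialQuotient-⊕ φ (suc t) m {u} uᵢ≡0 = begin
      lin φ (monomialQuotient (suc t) (m ⊕ u))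
        ≈⟨ lin-monomialQuotient φ t (m ⊕ u) ⟩
      -- `ψ` bundles both summands into one function of the monomial, so that a single identity of
      -- monomials rewrites them together.
      ψ (m ⊕ u ⊖ power i e)
        ≈⟨ ≡⇒φ ψ (⊕-⊖-power m u i e uᵢ≡0) ⟩
      φ (m′ ⊕ u) + lin (λ w → φ (w ⊕ power b e)) (monomialQuotient t (m′ ⊕ u))
        ≈⟨ +-congˡ (monomialQuotient-⊕ _ t m′ uᵢ≡0) ⟩
      φ (m′ ⊕ u) + lin (λ w → φ (w ⊕ u ⊕ power b e)) (monomialQuotient t m′)
        ≈⟨ +-congˡ (lin-ext (λ w → ≡⇒φ φ (swap w)) (monomialQuotient t m′)) ⟩
      φ (m′ ⊕ u) + lin (λ w → φ (w ⊕ power b e ⊕ u)) (monomialQuotient t m′)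
        ≈⟨ lin-monomialQuotient (λ w → φ (w ⊕ u)) t m ⟨
      lin (λ w → φ (w ⊕ u)) (monomialQuotient (suc t) m) ∎
      where
      m′ = m ⊖ power i e
      ψ  = λ m → φ m + lin (λ w → φ (w ⊕ power b e)) (monomialQuotient t m)
      swap : ∀ w → w ⊕ u ⊕ power b e ≡ w ⊕ power b e ⊕ u
      swap w = ≡.trans (⊕-assoc w u _) (≡.trans (≡.cong (w ⊕_) (⊕-comm u _)) (≡.sym (⊕-assoc w _ u)))

    -- This is linearity over the polynomials free of `X_i`: the factor `u` leaves the exponent of
    -- `X_i`, and with it the number of division steps, unchanged.
    divided-⊕ : ∀ φ m {u} → lookup u i ≡ 0 →
                lin φ (divided (m ⊕ u)) ≈ lin (λ w → φ (w ⊕ u)) (divided m)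
    divided-⊕ φ m {u} uᵢ≡0 rewrite Vec.lookup-zipWith ℕ._+_ i m u | uᵢ≡0 | ℕ.+-identityʳ (lookup m i) =
      monomialQuotient-⊕ φ (lookup m i / e) m uᵢ≡0

    -- One more factor `X_i^e` means exactly one more division step. That step contributes `m`, and
    -- the later ones contribute the old quotient times `X_b^e`.
    divided-power : ∀ φ m → lin φ (divided (m ⊕ power i e)) ≈
                            φ m + lin (λ w → φ (w ⊕ power b e)) (divided m)
    divided-power φ m = begin
      lin φ (monomialQuotient (lookup (m ⊕ power i e) i / e) (m ⊕ power i e))
        ≡⟨ ≡.cong (λ t → lin φ (monomialQuotient t (m ⊕ power i e))) count ⟩
      lin φ (monomialQuotient (suc t) (m ⊕ power i e))
        ≈⟨ lin-monomialQuotient φ t (m ⊕ power i e) ⟩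
      ψ (m ⊕ power i e ⊖ power i e)
        ≈⟨ ≡⇒φ ψ (⊕-⊖-cancel m (power i e)) ⟩
      ψ m ∎
      where
      t = lookup m i / e
      ψ = λ m → φ m + lin (λ w → φ (w ⊕ power b e)) (monomialQuotient t m)
      count : lookup (m ⊕ power i e) i / e ≡ suc t
      count rewrite Vec.lookup-zipWith ℕ._+_ i m (power i e) | lookup-power i e =
        ≡.trans (ℕ.m/n≡1+[m∸n]/n (ℕ.m≤n+m e (lookup m i)))
                (≡.cong (λ d → suc (d / e)) (ℕ.m+n∸n≡m (lookup m i) e))

    divide-cong : ∀ {p q} → p ≋ q → divide p ≋ divide q
    divide-cong {p} {q} p≋q = ≋-from-lin λ φ →
      trans (lin-divide φ p) (trans (lin-cong _ p≋q) (sym (lin-divide φ q)))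

    divide-++ : ∀ p q → divide (p ++ q) ≋ divide p +ₚ divide q
    divide-++ p q = ≋-from-lin λ φ → begin
      lin φ (divide (p ++ q))                ≈⟨ lin-divide φ (p ++ q) ⟩
      lin _ (p ++ q)                         ≈⟨ lin-++ _ p q ⟩
      lin _ p + lin _ q                      ≈⟨ +-cong (lin-divide φ p) (lin-divide φ q) ⟨
      lin φ (divide p) + lin φ (divide q)    ≈⟨ lin-++ φ (divide p) (divide q) ⟨
      lin φ (divide p ++ divide q)           ∎

    divide-*ₚ : ∀ p {u v} → lookup u i ≡ 0 → lookup v i ≡ 0 →
                divide (p *ₚ binomial u v) ≋ divide p *ₚ binomial u v
    divide-*ₚ p {u} {v} uᵢ≡0 vᵢ≡0 = ≋-from-lin λ φ → begin
      lin φ (divide (p *ₚ binomial u v))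
        ≈⟨ lin-divide φ (p *ₚ binomial u v) ⟩
      lin (λ m → lin φ (divided m)) (p *ₚ binomial u v)
        ≈⟨ lin-*ₚ-binomial _ p u v ⟩
      lin (λ m → lin φ (divided (m ⊕ u)) - lin φ (divided (m ⊕ v))) p
        ≈⟨ lin-ext (λ m → +-cong (divided-⊕ φ m uᵢ≡0) (-‿cong (divided-⊕ φ m vᵢ≡0))) p ⟩
      lin (λ m → lin (λ w → φ (w ⊕ u)) (divided m) - lin (λ w → φ (w ⊕ v)) (divided m)) p
        ≈⟨ lin-ext (λ m → lin-- _ _ (divided m)) p ⟨
      lin (λ m → lin (λ w → φ (w ⊕ u) - φ (w ⊕ v)) (divided m)) p
        ≈⟨ lin-divide _ p ⟨
      lin (λ w → φ (w ⊕ u) - φ (w ⊕ v)) (divide p)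
        ≈⟨ lin-*ₚ-binomial φ (divide p) u v ⟨
      lin φ (divide p *ₚ binomial u v) ∎

    divisor : Poly K s
    divisor = binomial (power i e) (power b e)

    -- By `divided-power` the half `X_i^e` of the divisor yields `p` plus `X_b^e` times the quotient
    -- of `p`; by `divided-⊕` the half `X_b^e` yields the same second part, and the two cancel.
    divide-divisor : ∀ p → divide (p *ₚ divisor) ≋ p
    divide-divisor p = ≋-from-lin λ φ → begin
      lin φ (divide (p *ₚ divisor))
        ≈⟨ lin-divide φ (p *ₚ divisor) ⟩
      lin (λ m → lin φ (divided m)) (p *ₚ divisor)
        ≈⟨ lin-*ₚ-binomial _ p (power i e) (power b e) ⟩
      lin (λ m → lin φ (divided (m ⊕ power i e)) - lin φ (divided (m ⊕ power b e))) p
        ≈⟨ lin-ext (λ m → trans (+-cong (divided-power φ m) (-‿cong (divided-⊕ φ m free))) (x+y-y≈x _ _)) p ⟩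
      lin φ p ∎
      where
      free : lookup (power b e) i ≡ 0
      free = lookup-power-≢ e (b≢i ∘ ≡.sym)
      x+y-y≈x : ∀ x y → x + y - y ≈ x
      x+y-y≈x x y = trans (+-assoc x y (- y)) (trans (+-congˡ (-‿inverseʳ y)) (+-identityʳ x))

    FreeBinomial : Pred (Poly K s) _
    FreeBinomial h = ∃[ u ] ∃[ v ] lookup u i ≡ 0 × lookup v i ≡ 0 × h ≋ binomial u v

    -- The multiplier `r` makes the induction go through: in the case `*-closed` the new factor is
    -- absorbed into it, since `divide` is not linear over factors that involve `X_i`.
    divide-ideal : ∀ {g} {G : Pred (Poly K s) g} → (∀ {h} → G h → FreeBinomial h) →
                   ∀ {h} → Ideal G h → ∀ r → Ideal G (divide (r *ₚ h))
    divide-ideal free {h} (generator h∈) r with free h∈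
    ... | u , v , uᵢ≡0 , vᵢ≡0 , h≋ = ≋-closed
      (≋-trans (*ₚ-cong (≋-refl {p = divide r}) h≋)
        (≋-trans (≋-sym (divide-*ₚ r uᵢ≡0 vᵢ≡0))
          (divide-cong (*ₚ-cong (≋-refl {p = r}) (≋-sym h≋)))))
      (*-closed (divide r) (generator h∈))
    divide-ideal free 0∈ r = ≋-closed (divide-cong {0ₚ} (≋-sym (P.zeroʳ r))) 0∈
      where module P = CommutativeRing (polynomialCommutativeRing s)
    divide-ideal free (+-closed {p} {q} p∈ q∈) r = ≋-closed
      (≋-trans (≋-sym (divide-++ (r *ₚ p) (r *ₚ q))) (divide-cong (≋-sym (P.distribˡ r p q))))
      (+-closed (divide-ideal free p∈ r) (divide-ideal free q∈ r))
      where module P = CommutativeRing (polynomialCommutativeRing s)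
    divide-ideal free (*-closed r′ {p} p∈) r = ≋-closed
      (divide-cong (*ₚ-assoc r r′ p)) (divide-ideal free p∈ (r *ₚ r′))
    divide-ideal free (≈-closed p≈q p∈) r = ≋-closed
      (divide-cong (*ₚ-cong (≋-refl {p = r}) (≈ₚ⇒≋ p≈q))) (divide-ideal free p∈ r)

    -- If `divisor *ₚ y` lies in the ideal, so does its quotient, which is `y`. The summand `0ₚ`
    -- arises because vanishing in the quotient ring means that the difference with zero lies in the
    -- ideal.
    nonZeroDivisor : ∀ {g} {G : Pred (Poly K s) g} → (∀ {h} → G h → FreeBinomial h) →
                     NonZeroDivisor (quotient (polynomialRing K s) (Ideal G)) divisor
    nonZeroDivisor free y dy∈ = ≋-closed
      (≋-trans (divide-cong (P.*-identityˡ (divisor *ₚ y +ₚ 0ₚ)))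
        (≋-trans (divide-cong (≋-trans (P.+-identityʳ (divisor *ₚ y)) (*ₚ-comm divisor y)))
          (≋-trans (divide-divisor y) (≋-sym (P.+-identityʳ y)))))
      (divide-ideal free dy∈ 1ₚ)
      where module P = CommutativeRing (polynomialCommutativeRing s)

  -- Triangular systems of binomials: regularity and normal forms.

  module Triangular {r} (e : Fin r → ℕ) (b : Fin r → Fin (suc r))
                    (e≢0 : ∀ i → NonZero (e i)) (b≤ : ∀ i → toℕ (b i) ℕ.≤ toℕ i) where

    -- The coordinate suc i of Fin (suc r) is eliminated by f i.
    f : Fin r → Poly K (suc r)
    f i = binomial (power (suc i) (e i)) (power (b i) (e i))

    IsF : Pred (Poly K (suc r)) _
    IsF h = ∃[ i ] h ≈ₚ f i

    -- For `j < i` both variables of `f j`, with indices `suc j` and `b j`, come before `suc i`; so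
    -- all predecessors are free of the variable in which `f i` is divided out.
    f-regular : IsRegularSequence (polynomialRing K (suc r)) f
    f-regular i = Division.nonZeroDivisor (suc i) (b i) (<⇒≢ (ℕ.s≤s (b≤ i))) (e i) {{e≢0 i}} free
      where
      <⇒≢ : ∀ {n} {j k : Fin n} → toℕ j ℕ.< toℕ k → j ≢ k
      <⇒≢ j<k ≡.refl = ℕ.<-irrefl ≡.refl j<k
      free : ∀ {h} → ∃[ j ] j Fin.< i × h ≈ₚ f j →
             Division.FreeBinomial (suc i) (b i) (<⇒≢ (ℕ.s≤s (b≤ i))) (e i) {{e≢0 i}} h
      free (j , j<i , h≈) = power (suc j) (e j) , power (b j) (e j)
        , lookup-power-≢ (e j) (<⇒≢ (ℕ.s≤s j<i) ∘ ≡.sym)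
        , lookup-power-≢ (e j) (<⇒≢ (ℕ.s≤s (ℕ.≤-trans (b≤ j) (ℕ.<⇒≤ j<i))) ∘ ≡.sym)
        , ≈ₚ⇒≋ h≈

    Reduced : Monomial (suc r) → Set
    Reduced m = ∀ i → lookup m (suc i) ℕ.< e i

    -- The degree is recorded so that reducing a homogeneous polynomial keeps it homogeneous, on
    -- which setting `X_0` to 1 relies later.
    NormalForm : Monomial (suc r) → Set _
    NormalForm m = ∃[ m′ ] Reduced m′ × Vec.sum m′ ≡ Vec.sum m × Ideal IsF (binomial m m′)

    module Step m i (e≤ : e i ℕ.≤ lookup m (suc i)) where
      m₀ = m ⊖ power (suc i) (e i)
      m₁ = m₀ ⊕ power (b i) (e i)

      restore : m₀ ⊕ power (suc i) (e i) ≡ m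
      restore = ⊖-⊕-power m (suc i) e≤

      lighter : weight m₁ ℕ.< weight m
      lighter = ≡.subst (λ w → weight m₁ ℕ.< weight w) restore
        (weight-⊕-power m₀ {b i} {suc i} (e i) {{e≢0 i}} (ℕ.s≤s (b≤ i)))

      degree≡ : Vec.sum m₁ ≡ Vec.sum m
      degree≡ = ≡.trans (sum-⊕-power m₀ {b i} {suc i} (e i)) (≡.cong Vec.sum restore)

      -- `m₀` times `f i` is the difference of `m` and `m₁`, so `m₁` cancels.
      telescope : ∀ m′ φ → lin φ (term 1# m₀ *ₚ f i +ₚ binomial m₁ m′) ≈ lin φ (binomial m m′)
      telescope m′ φ = begin
        lin φ (term 1# m₀ *ₚ f i +ₚ binomial m₁ m′)
          ≈⟨ lin-++ φ (term 1# m₀ *ₚ f i) (binomial m₁ m′) ⟩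
        lin φ (term 1# m₀ *ₚ f i) + lin φ (binomial m₁ m′)
          ≈⟨ +-cong (trans (lin-*ₚ-binomial φ (term 1# m₀) _ _) (trans (+-identityʳ _) (*-identityˡ _))) (lin-binomial φ m₁ m′) ⟩
        φ (m₀ ⊕ power (suc i) (e i)) - φ m₁ + (φ m₁ - φ m′)
          ≈⟨ +-congʳ (+-congʳ (≡⇒φ φ restore)) ⟩
        φ m - φ m₁ + (φ m₁ - φ m′)
          ≈⟨ +-assoc _ _ _ ⟩
        φ m + (- φ m₁ + (φ m₁ - φ m′))
          ≈⟨ +-congˡ (trans (sym (+-assoc _ _ _)) (trans (+-congʳ (-‿inverseˡ _)) (+-identityˡ _))) ⟩
        φ m - φ m′
          ≈⟨ lin-binomial φ m m′ ⟨
        lin φ (binomial m m′) ∎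

    -- A step may push the exponent of the earlier variable `b i` above its own bound, so the excess
    -- exponents need not shrink one by one. The weight does: it drops by `e i` times the distance
    -- between the two coordinates.
    normalForm : ∀ m → Acc ℕ._<_ (weight m) → NormalForm m
    normalForm m (acc rec) with Fin.any? (λ i → e i ℕ.≤? lookup m (suc i))
    ... | no  none     = m , (λ i → ℕ.≰⇒> λ e≤ → none (i , e≤)) , ≡.refl , ≋-closed
      (≋-from-lin λ φ → sym (trans (lin-binomial φ m m) (-‿inverseʳ _))) 0∈
    ... | yes (i , e≤) =
      let open Step m i e≤
          m′ , reduced , sum≡ , m₁-m′∈ = normalForm m₁ (rec lighter)
      in m′ , reduced , ≡.trans sum≡ degree≡ ,
         ≋-closed (≋-from-lin (telescope m′))
           (+-closed (*-closed (term 1# m₀) (generator {x = f i} (i , λ _ → refl))) m₁-m′∈)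

    reduce : Monomial (suc r) → Monomial (suc r)
    reduce m = proj₁ (normalForm m (<-wellFounded (weight m)))

    reduce-reduced : ∀ m → Reduced (reduce m)
    reduce-reduced m = proj₁ (proj₂ (normalForm m (<-wellFounded (weight m))))

    sum-reduce : ∀ m → Vec.sum (reduce m) ≡ Vec.sum m
    sum-reduce m = proj₁ (proj₂ (proj₂ (normalForm m (<-wellFounded (weight m)))))

    reduce-congruent : ∀ m → Ideal IsF (binomial m (reduce m))
    reduce-congruent m = proj₂ (proj₂ (proj₂ (normalForm m (<-wellFounded (weight m)))))

-- Nonzero elements of a finite field, and polynomials vanishing on grids.

module FiniteField {c ℓ} (K : CommutativeRing c ℓ) {n} (isFiniteField : IsFiniteField K (suc n)) where
  open CommutativeRing K hiding (zero)
  open IsFiniteField isFiniteField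
  open Polynomials K
  open Inverse enumeration using (to; from; from-cong; strictlyInverseˡ; strictlyInverseʳ)
  open RingProperties ring using (-‿distribˡ-*)
  open Exp semiring using (_^_)
  open SetoidReasoning setoid
  private module ∏ = Sum *-commutativeMonoid

  cancelˡ : ∀ {x y} → ¬ x ≈ 0# → x * y ≈ 0# → y ≈ 0#
  cancelˡ {x} {y} x≉0 xy≈0 = let x⁻¹ , xx⁻¹≈1 = inverse x x≉0 in begin
    y                ≈⟨ *-identityˡ y ⟨
    1# * y           ≈⟨ *-congʳ (trans (*-comm x⁻¹ x) xx⁻¹≈1) ⟨
    x⁻¹ * x * y      ≈⟨ *-assoc x⁻¹ x y ⟩
    x⁻¹ * (x * y)    ≈⟨ *-congˡ xy≈0 ⟩
    x⁻¹ * 0#         ≈⟨ zeroʳ x⁻¹ ⟩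
    0#               ∎

  *-≉0 : ∀ {x y} → ¬ x ≈ 0# → ¬ y ≈ 0# → ¬ x * y ≈ 0#
  *-≉0 x≉0 y≉0 = y≉0 ∘ cancelˡ x≉0

  *-cancelˡ-- : ∀ {x y h} → ¬ x ≈ y → x * h ≈ y * h → h ≈ 0#
  *-cancelˡ-- {x} {y} {h} x≉y xh≈yh = cancelˡ (x≉y ∘ x-y≈0⇒x≈y) (begin
    (x - y) * h        ≈⟨ distribʳ h x (- y) ⟩
    x * h + - y * h    ≈⟨ +-congˡ (-‿distribˡ-* y h) ⟨
    x * h - y * h      ≈⟨ trans (+-congʳ xh≈yh) (-‿inverseʳ _) ⟩
    0#                 ∎)

  -- `punchIn` skips the index of `0#`, so `Fin n`, where `n` is `q - 1`, enumerates exactly the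
  -- nonzero elements.
  unit : Fin n → Carrier
  unit i = to (punchIn (from 0#) i)

  unit-injective : ∀ {i j} → unit i ≈ unit j → i ≡ j
  unit-injective {i} {j} eq = Fin.punchIn-injective (from 0#) i j
    (≡.trans (≡.sym (strictlyInverseʳ _)) (≡.trans (from-cong eq) (strictlyInverseʳ _)))

  unit≉0 : ∀ i → ¬ unit i ≈ 0#
  unit≉0 i eq = Fin.punchInᵢ≢i (from 0#) i (≡.trans (≡.sym (strictlyInverseʳ _)) (from-cong eq))

  from0≢from : ∀ {x} → ¬ x ≈ 0# → from 0# ≢ from x
  from0≢from {x} x≉0 eq = x≉0 (begin
    x              ≈⟨ strictlyInverseˡ x ⟨
    to (from x)    ≡⟨ ≡.cong to eq ⟨
    to (from 0#)   ≈⟨ strictlyInverseˡ 0# ⟩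
    0#             ∎)

  index : ∀ {x} → ¬ x ≈ 0# → Fin n
  index x≉0 = punchOut (from0≢from x≉0)

  unit-index : ∀ {x} (x≉0 : ¬ x ≈ 0#) → unit (index x≉0) ≈ x
  unit-index {x} x≉0 = begin
    to (punchIn (from 0#) (index x≉0))   ≡⟨ ≡.cong to (Fin.punchIn-punchOut (from0≢from x≉0)) ⟩
    to (from x)                          ≈⟨ strictlyInverseˡ x ⟩
    x                                    ∎

  order≢0 : NonZero n
  order≢0 = Fin.nonZeroIndex (index (0≉1 ∘ sym))

  scaleUnit : ∀ {t} → ¬ t ≈ 0# → Fin n → Fin n
  scaleUnit t≉0 i = index (*-≉0 t≉0 (unit≉0 i))

  unit-scaleUnit : ∀ {t} (t≉0 : ¬ t ≈ 0#) i → unit (scaleUnit t≉0 i) ≈ t * unit i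
  unit-scaleUnit t≉0 i = unit-index (*-≉0 t≉0 (unit≉0 i))

  scaleUnit-inverse : ∀ {t t⁻¹} (t≉0 : ¬ t ≈ 0#) (t⁻¹≉0 : ¬ t⁻¹ ≈ 0#) → t * t⁻¹ ≈ 1# →
                      ∀ i → scaleUnit t≉0 (scaleUnit t⁻¹≉0 i) ≡ i
  scaleUnit-inverse {t} {t⁻¹} t≉0 t⁻¹≉0 tt⁻¹≈1 i = unit-injective (begin
    unit (scaleUnit t≉0 (scaleUnit t⁻¹≉0 i))   ≈⟨ unit-scaleUnit t≉0 _ ⟩
    t * unit (scaleUnit t⁻¹≉0 i)               ≈⟨ *-congˡ (unit-scaleUnit t⁻¹≉0 i) ⟩
    t * (t⁻¹ * unit i)                         ≈⟨ *-assoc t t⁻¹ _ ⟨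
    t * t⁻¹ * unit i                           ≈⟨ *-congʳ tt⁻¹≈1 ⟩
    1# * unit i                                ≈⟨ *-identityˡ _ ⟩
    unit i                                     ∎)

  ∏-≉0 : ∀ {m} (x : Vector Carrier m) → (∀ i → ¬ x i ≈ 0#) → ¬ ∏.sum x ≈ 0#
  ∏-≉0 {zero}  x x≉0 = 0≉1 ∘ sym
  ∏-≉0 {suc m} x x≉0 = *-≉0 (x≉0 zero) (∏-≉0 (x ∘ suc) (x≉0 ∘ suc))

  -- Multiplication by t permutes the nonzero elements, so it fixes their product P.
  fermat : ∀ {t} → ¬ t ≈ 0# → t ^ n ≈ 1#
  fermat {t} t≉0 = begin
    t ^ n                ≈⟨ *-identityʳ _ ⟨
    t ^ n * 1#           ≈⟨ *-congˡ PP⁻¹≈1 ⟨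
    t ^ n * (P * P⁻¹)    ≈⟨ *-assoc _ P P⁻¹ ⟨
    t ^ n * P * P⁻¹      ≈⟨ *-congʳ P≈t^nP ⟨
    P * P⁻¹              ≈⟨ PP⁻¹≈1 ⟩
    1#                   ∎
    where
    P = ∏.sum unit
    P⁻¹ = proj₁ (inverse P (∏-≉0 unit unit≉0))
    PP⁻¹≈1 = proj₂ (inverse P (∏-≉0 unit unit≉0))
    t⁻¹ = proj₁ (inverse t t≉0)
    tt⁻¹≈1 = proj₂ (inverse t t≉0)
    t⁻¹≉0 : ¬ t⁻¹ ≈ 0#
    t⁻¹≉0 t⁻¹≈0 = 0≉1 (trans (sym (zeroʳ t)) (trans (*-congˡ (sym t⁻¹≈0)) tt⁻¹≈1))
    π : Permutation n n
    π = permutation (scaleUnit t≉0) (scaleUnit t⁻¹≉0)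
          (scaleUnit-inverse t≉0 t⁻¹≉0 tt⁻¹≈1)
          (scaleUnit-inverse t⁻¹≉0 t≉0 (trans (*-comm t⁻¹ t) tt⁻¹≈1))
    P≈t^nP : P ≈ t ^ n * P
    P≈t^nP = begin
      ∏.sum unit                                   ≈⟨ ∏.sum-permute unit π ⟩
      ∏.sum (λ i → unit (π ⟨$⟩ʳ i))                ≈⟨ ∏.sum-cong-≋ (unit-scaleUnit t≉0) ⟩
      ∏.sum (λ i → t * unit i)                     ≈⟨ ∏.∑-distrib-+ (λ _ → t) unit ⟩
      ∏.sum (Vector.replicate n t) * P             ≈⟨ *-congʳ (∏.sum-replicate n) ⟩
      t ^ n * P                                    ∎

  horner : ∀ {m} → Vector Carrier m → Carrier → Carrier
  horner {zero}  c x = 0#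
  horner {suc m} c x = c zero + x * horner (c ∘ suc) x

  -- The coefficients of the quotient of the polynomial c by X - y.
  synthetic : ∀ {m} → Carrier → Vector Carrier (suc m) → Vector Carrier m
  synthetic y c zero    = horner (c ∘ suc) y
  synthetic y c (suc i) = synthetic y (c ∘ suc) i

  -- This is `c(x) - c(y) = (x - y) Q(x)` with the negative terms moved across, so that the
  -- induction only rearranges sums and products.
  horner-synthetic : ∀ {m} y (c : Vector Carrier (suc m)) x →
    horner c x + y * horner (synthetic y c) x ≈ horner c y + x * horner (synthetic y c) x
  horner-synthetic {zero}  y c x = +-cong (+-congˡ (trans (zeroʳ x) (sym (zeroʳ y)))) (trans (zeroʳ y) (sym (zeroʳ x)))
  horner-synthetic {suc m} y c x = begin
    c zero + x * Px + y * H         ≈⟨ +-congʳ (+-comm _ _) ⟩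
    x * Px + c zero + y * H         ≈⟨ +-assoc _ _ _ ⟩
    x * Px + (c zero + y * (Py + x * Q)) ≈⟨ +-congˡ (+-congˡ (trans (distribˡ y Py _) (+-congˡ (x∙yz≈y∙xz y x Q)))) ⟩
    x * Px + (c zero + (y * Py + x * (y * Q))) ≈⟨ +-congˡ (+-assoc _ _ _) ⟨
    x * Px + (c zero + y * Py + x * (y * Q))   ≈⟨ +x∙yz≈y∙xz _ _ _ ⟩
    c zero + y * Py + (x * Px + x * (y * Q))   ≈⟨ +-congˡ (distribˡ x Px _) ⟨
    c zero + y * Py + x * (Px + y * Q)         ≈⟨ +-congˡ (*-congˡ (horner-synthetic y (c ∘ suc) x)) ⟩
    c zero + y * Py + x * (Py + x * Q)         ∎
    where
    open CommutativeSemigroupProperties *-commutativeSemigroup using (x∙yz≈y∙xz)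
    open CommutativeSemigroupProperties +-commutativeSemigroup using () renaming (x∙yz≈y∙xz to +x∙yz≈y∙xz)
    Px = horner (c ∘ suc) x
    Py = horner (c ∘ suc) y
    Q  = horner (synthetic y (c ∘ suc)) x
    H  = horner (synthetic y c) x

  -- Quotient and remainder determine `c`. The recursion works because the leading entry
  -- `synthetic y c zero` is the remainder of the tail `c ∘ suc`.
  synthetic≈0 : ∀ {m} y (c : Vector Carrier (suc m)) → (∀ i → synthetic y c i ≈ 0#) →
                horner c y ≈ 0# → ∀ i → c i ≈ 0#
  synthetic≈0 {zero}  y c q≈0 cy≈0 zero = trans (sym (trans (+-congˡ (zeroʳ y)) (+-identityʳ _))) cy≈0
  synthetic≈0 {suc m} y c q≈0 cy≈0 zero =
    trans (sym (trans (+-congˡ (trans (*-congˡ (q≈0 zero)) (zeroʳ y))) (+-identityʳ _))) cy≈0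
  synthetic≈0 {suc m} y c q≈0 cy≈0 (suc i) = synthetic≈0 y (c ∘ suc) (q≈0 ∘ suc) (q≈0 zero) i

  -- Dividing by `X - x zero` uses up one root and one coefficient; at every other root the nonzero
  -- factor cancels, so the quotient vanishes there.
  roots⇒≈0 : ∀ {m} (c x : Vector Carrier m) → (∀ {i j} → x i ≈ x j → i ≡ j) →
             (∀ i → horner c (x i) ≈ 0#) → ∀ i → c i ≈ 0#
  roots⇒≈0 {suc m} c x x-injective cx≈0 = synthetic≈0 y c
    (roots⇒≈0 (synthetic y c) (x ∘ suc) (Fin.suc-injective ∘ x-injective) root) (cx≈0 zero)
    where
    y = x zero
    root : ∀ i → horner (synthetic y c) (x (suc i)) ≈ 0#
    root i = *-cancelˡ-- {x (suc i)} {y} (λ eq → Fin.0≢1+n (≡.sym (x-injective eq))) (begin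
      x (suc i) * H                            ≈⟨ +-identityˡ _ ⟨
      0# + x (suc i) * H                       ≈⟨ +-congʳ (cx≈0 zero) ⟨
      horner c y + x (suc i) * H               ≈⟨ horner-synthetic y c (x (suc i)) ⟨
      horner c (x (suc i)) + y * H             ≈⟨ +-congʳ (cx≈0 (suc i)) ⟩
      0# + y * H                               ≈⟨ +-identityˡ _ ⟩
      y * H                                    ∎)
      where H = horner (synthetic y c) (x (suc i))

  horner-cong : ∀ {m} {c d : Vector Carrier m} x → (∀ i → c i ≈ d i) → horner c x ≈ horner d x
  horner-cong {zero}  x c≈d = refl
  horner-cong {suc m} x c≈d = +-cong (c≈d zero) (*-congˡ (horner-cong x (c≈d ∘ suc)))

  horner-0 : ∀ m x → horner {m} (λ _ → 0#) x ≈ 0#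
  horner-0 zero    x = refl
  horner-0 (suc m) x = trans (+-identityˡ _) (trans (*-congˡ (horner-0 m x)) (zeroʳ x))

  horner-+ : ∀ {m} (c d : Vector Carrier m) x → horner (λ i → c i + d i) x ≈ horner c x + horner d x
  horner-+ {zero}  c d x = sym (+-identityˡ 0#)
  horner-+ {suc m} c d x = trans
    (+-congˡ (trans (*-congˡ (horner-+ (c ∘ suc) (d ∘ suc) x)) (distribˡ x _ _)))
    (interchange _ _ _ _)
    where open CommutativeSemigroupProperties +-commutativeSemigroup using (interchange)

  horner-single : ∀ {m} (c : Vector Carrier m) x j → (∀ i → i ≢ j → c i ≈ 0#) →
                  horner c x ≈ c j * x ^ toℕ j
  horner-single {suc m} c x zero c≈0 = begin
    c zero + x * horner (c ∘ suc) x    ≈⟨ +-congˡ (*-congˡ (trans (horner-cong x (λ i → c≈0 (suc i) λ ())) (horner-0 m x))) ⟩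
    c zero + x * 0#                    ≈⟨ +-congˡ (zeroʳ x) ⟩
    c zero + 0#                        ≈⟨ +-identityʳ _ ⟩
    c zero                             ≈⟨ *-identityʳ _ ⟨
    c zero * 1#                        ∎
  horner-single {suc m} c x (suc j) c≈0 = begin
    c zero + x * horner (c ∘ suc) x    ≈⟨ +-cong (c≈0 zero λ ()) (*-congˡ (horner-single (c ∘ suc) x j
                                            λ i i≢j → c≈0 (suc i) (i≢j ∘ Fin.suc-injective))) ⟩
    0# + x * (c (suc j) * x ^ toℕ j)   ≈⟨ +-identityˡ _ ⟩
    x * (c (suc j) * x ^ toℕ j)        ≈⟨ x∙yz≈y∙xz _ _ _ ⟩
    c (suc j) * (x * x ^ toℕ j)        ∎
    where open CommutativeSemigroupProperties *-commutativeSemigroup using (x∙yz≈y∙xz)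

  substitute : ∀ {s} → Carrier → Poly K (suc s) → Poly K s
  substitute x = List.map λ (a , m) → a * x ^ Vec.head m , Vec.tail m

  eval-substitute : ∀ {s} (p : Poly K (suc s)) x →
                    eval K (substitute (x zero) p) (x ∘ suc) ≈ eval K p x
  eval-substitute []                x = refl
  eval-substitute ((a , e ∷ m) ∷ p) x = +-cong (*-assoc _ _ _) (eval-substitute p x)

  -- The bound `d` on the exponents of the first variable makes each coefficient after substitution
  -- the value of a polynomial with `d` coefficients, to which `roots⇒≈0` applies.
  coeff-substitute : ∀ {s d} (p : Poly K (suc s)) → All (λ (_ , m) → Vec.head m ℕ.< d) p → ∀ x m →
                     coeff K (substitute x p) m ≈ horner (λ (i : Fin d) → coeff K p (toℕ i ∷ m)) x
  coeff-substitute {d = d} []                []          x m = sym (horner-0 d x)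
  coeff-substitute {d = d} ((a , e ∷ u) ∷ p) (e<d ∷ p<d) x m = begin
    (if does (u ≟ₘ m) then a * x ^ e else 0#) + coeff K (substitute x p) m
      ≈⟨ +-cong (sym (head (u ≟ₘ m))) (coeff-substitute p p<d x m) ⟩
    horner indicator x + horner {d} (λ i → coeff K p (toℕ i ∷ m)) x
      ≈⟨ horner-+ indicator (λ i → coeff K p (toℕ i ∷ m)) x ⟨
    horner (λ (i : Fin d) → coeff K ((a , e ∷ u) ∷ p) (toℕ i ∷ m)) x ∎
    where
    indicator : Fin d → Carrier
    indicator i = if does ((e ∷ u) ≟ₘ (toℕ i ∷ m)) then a else 0#
    vanish : ∀ i → e ∷ u ≢ toℕ i ∷ m → indicator i ≈ 0#
    vanish i ≢ rewrite dec-false ((e ∷ u) ≟ₘ (toℕ i ∷ m)) ≢ = refl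
    attain : ∀ i → e ∷ u ≡ toℕ i ∷ m → indicator i ≈ a
    attain i eq rewrite dec-true ((e ∷ u) ≟ₘ (toℕ i ∷ m)) eq = refl
    head : (u≟m : Dec (u ≡ m)) → horner indicator x ≈ (if does u≟m then a * x ^ e else 0#)
    head (no u≢m)     = trans (horner-cong x λ i → vanish i (u≢m ∘ Vec.∷-injectiveʳ)) (horner-0 d x)
    head (yes ≡.refl) = begin
      horner indicator x                   ≈⟨ horner-single indicator x j (λ i i≢j → vanish i λ eq →
                                                i≢j (Fin.toℕ-injective (≡.trans (≡.sym (Vec.∷-injectiveˡ eq)) (≡.sym toℕj≡e)))) ⟩
      indicator j * x ^ toℕ j              ≈⟨ *-cong (attain j (≡.cong (_∷ u) (≡.sym toℕj≡e))) (reflexive (≡.cong (x ^_) toℕj≡e)) ⟩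
      a * x ^ e                            ∎
      where
      j = fromℕ< e<d
      toℕj≡e = Fin.toℕ-fromℕ< e<d

  -- By induction, fixing the first variable at a node leaves the zero polynomial in the others.
  -- Each of its coefficients is a polynomial of degree below `e zero` in the first variable, and so
  -- has `e zero` distinct roots.
  vanishing-on-grid : ∀ {s} (e : Fin s → ℕ) (x : ∀ i → Vector Carrier (e i)) →
    (∀ i {j k} → x i j ≈ x i k → j ≡ k) →
    (p : Poly K s) → All (λ (_ , m) → ∀ i → lookup m i ℕ.< e i) p →
    (∀ (g : ∀ i → Fin (e i)) → eval K p (λ i → x i (g i)) ≈ 0#) → p ≈ₚ 0ₚ
  vanishing-on-grid {zero} e x x-injective p p<e p≈0 [] = trans (constant p) (p≈0 λ ())
    where
    constant : ∀ p {x} → coeff K p [] ≈ eval K p x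
    constant []             = refl
    constant ((a , []) ∷ p) = +-cong (sym (*-identityʳ a)) (constant p)
  vanishing-on-grid {suc s} e x x-injective p p<e p≈0 (d ∷ m) with d ℕ.<? e zero
  ... | yes d<e = trans (reflexive (≡.cong (λ d → coeff K p (d ∷ m)) (≡.sym (Fin.toℕ-fromℕ< d<e))))
    (roots⇒≈0 (λ i → coeff K p (toℕ i ∷ m)) (x zero) (x-injective zero) root (fromℕ< d<e))
    where
    root : ∀ j → horner (λ (i : Fin (e zero)) → coeff K p (toℕ i ∷ m)) (x zero j) ≈ 0#
    root j = trans
      (sym (coeff-substitute p (All.map (λ { {_ , _ ∷ _} <e → <e zero }) p<e) (x zero j) m))
      (vanishing-on-grid (e ∘ suc) (λ i → x (suc i)) (λ i → x-injective (suc i)) (substitute (x zero j) p)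
        (All.map⁺ (All.map (λ { {_ , _ ∷ _} <e i → <e (suc i) }) p<e))
        (λ g → trans (eval-substitute p (λ i → x i (extend g i))) (p≈0 (extend g)))
        m)
      where
      extend : (∀ i → Fin (e (suc i))) → ∀ i → Fin (e i)
      extend g zero    = j
      extend g (suc i) = g i
  ... | no d≮e = coeff-∉ (All.map (λ { <e ≡.refl → d≮e (<e zero) }) p<e)

-- Partition of the coordinates into blocks.

module ∑ = SemiringSum ℕ.+-*-semiring

∑ : ∀ {n} → Vector ℕ n → ℕ
∑ = ∑.sum

start-suc : ∀ {k} (n : Fin k → ℕ) {i j} → i Fin.< j → start n i ℕ.+ n i ℕ.≤ start n j
start-suc n {zero}  {suc j} _           = ℕ.m≤m+n (n zero) _
start-suc n {suc i} {suc j} (ℕ.s≤s i<j) = begin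
  n zero ℕ.+ start (n ∘ suc) i ℕ.+ n (suc i)    ≡⟨ ℕ.+-assoc (n zero) _ _ ⟩
  n zero ℕ.+ (start (n ∘ suc) i ℕ.+ n (suc i))  ≤⟨ ℕ.+-monoʳ-≤ (n zero) (start-suc (n ∘ suc) i<j) ⟩
  n zero ℕ.+ start (n ∘ suc) j                  ∎
  where open ℕ.≤-Reasoning hiding (start)

start-∑ : ∀ {k} (n : Fin k → ℕ) j → start n j ℕ.+ n j ℕ.≤ ∑ n
start-∑ n zero    = ℕ.m≤m+n (n zero) _
start-∑ n (suc j) = begin
  n zero ℕ.+ start (n ∘ suc) j ℕ.+ n (suc j)    ≡⟨ ℕ.+-assoc (n zero) _ _ ⟩
  n zero ℕ.+ (start (n ∘ suc) j ℕ.+ n (suc j))  ≤⟨ ℕ.+-monoʳ-≤ (n zero) (start-∑ (n ∘ suc) j) ⟩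
  n zero ℕ.+ ∑ (n ∘ suc)                        ∎
  where open ℕ.≤-Reasoning hiding (start)

InBlock-unique : ∀ {k s} (n : Fin k → ℕ) {i j} {x : Fin s} → InBlock n i x → InBlock n j x → i ≡ j
InBlock-unique n {i} {j} (si≤x , x<si) (sj≤x , x<sj) with Fin.<-cmp i j
... | tri≈ _ i≡j _ = i≡j
... | tri< i<j _ _ = contradiction (ℕ.<-≤-trans x<si (ℕ.≤-trans (start-suc n i<j) sj≤x)) (ℕ.<-irrefl ≡.refl)
... | tri> _ _ j<i = contradiction (ℕ.<-≤-trans x<sj (ℕ.≤-trans (start-suc n j<i) si≤x)) (ℕ.<-irrefl ≡.refl)

findBlock : ∀ {k} (n : Fin k → ℕ) {x} → x ℕ.< ∑ n →
            ∃[ j ] start n j ℕ.≤ x × x ℕ.< start n j ℕ.+ n j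
findBlock {suc k} n {x} x<∑ with x ℕ.<? n zero
... | yes x<n₀ = zero , ℕ.z≤n , x<n₀
... | no  x≮n₀ =
  let j , s≤y , y<s = findBlock (n ∘ suc) {x ∸ n zero}
        (ℕ.+-cancelˡ-< (n zero) _ _ (≡.subst (ℕ._< ∑ n) (≡.sym split) x<∑))
  in suc j
   , ≡.subst (start n (suc j) ℕ.≤_) split (ℕ.+-monoʳ-≤ (n zero) s≤y)
   , ≡.subst₂ ℕ._<_ split (≡.sym (ℕ.+-assoc (n zero) _ _)) (ℕ.+-monoʳ-< (n zero) y<s)
  where
  split : n zero ℕ.+ (x ∸ n zero) ≡ x
  split = ℕ.m+[n∸m]≡n (ℕ.≮⇒≥ x≮n₀)

-- Iverson brackets and the count of edges by degrees.

⟦_⟧ : ∀ {p} {P : Set p} → Dec P → ℕ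
⟦ P? ⟧ = if does P? then 1 else 0

⟦⟧-true : ∀ {p} {P : Set p} (P? : Dec P) → P → ⟦ P? ⟧ ≡ 1
⟦⟧-true P? p = ≡.cong (if_then 1 else 0) (dec-true P? p)

⟦⟧-false : ∀ {p} {P : Set p} (P? : Dec P) → ¬ P → ⟦ P? ⟧ ≡ 0
⟦⟧-false P? ¬p = ≡.cong (if_then 1 else 0) (dec-false P? ¬p)

module _ {a p} {A : Set a} {P : Pred A p} (P? : Decidable P) where

  length-filter-∷ : ∀ x xs → length (filter P? (x ∷ xs)) ≡ ⟦ P? x ⟧ ℕ.+ length (filter P? xs)
  length-filter-∷ x xs with P? x
  ... | yes _ = ≡.refl
  ... | no  _ = ≡.refl

  length-filter-++ : ∀ xs ys → length (filter P? (xs ++ ys)) ≡ length (filter P? xs) ℕ.+ length (filter P? ys)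
  length-filter-++ xs ys = ≡.trans (≡.cong length (List.filter-++ P? xs ys)) (List.length-++ (filter P? xs))

  length-filter-tabulate : ∀ {n} (f : Fin n → A) → length (filter P? (tabulate f)) ≡ ∑ λ i → ⟦ P? (f i) ⟧
  length-filter-tabulate {zero}  f = ≡.refl
  length-filter-tabulate {suc n} f =
    ≡.trans (length-filter-∷ (f zero) _) (≡.cong (⟦ P? (f zero) ⟧ ℕ.+_) (length-filter-tabulate (f ∘ suc)))

length-filter-cartesianProduct : ∀ {a b p} {A : Set a} {B : Set b} {P : Pred (A × B) p} (P? : Decidable P) →
  ∀ {m n} (f : Fin m → A) (g : Fin n → B) →
  length (filter P? (cartesianProduct (tabulate f) (tabulate g))) ≡ ∑ λ i → ∑ λ j → ⟦ P? (f i , g j) ⟧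
length-filter-cartesianProduct P? {zero}  f g = ≡.refl
length-filter-cartesianProduct P? {suc m} f g = ≡.trans
  (length-filter-++ P? (List.map (f zero ,_) (tabulate g)) _)
  (≡.cong₂ ℕ._+_
    (≡.trans (≡.cong (length ∘ filter P?) (List.map-tabulate g (f zero ,_))) (length-filter-tabulate P? (λ j → f zero , g j)))
    (length-filter-cartesianProduct P? (f ∘ suc) g))

-- Reads the position of `v` inside its pair `2i`, `2i + 1`. Vertices are counted from 0 here, so
-- the odd vertices are those in position `zero`.
oddIndicator : ∀ {k} → Fin (k ℕ.* 2) → ℕ
oddIndicator {k} v = ⟦ proj₂ (remQuot {k} 2 v) Fin.≟ zero ⟧

oddIndicator-oddVertex : ∀ {k} (i : Fin k) → oddIndicator {k} (oddVertex i) ≡ 1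
oddIndicator-oddVertex {k} i = ≡.cong (λ r → ⟦ proj₂ r Fin.≟ zero ⟧) (Fin.remQuot-combine {k} {2} i zero)

oddIndicator-evenVertex : ∀ {k} (i : Fin k) → oddIndicator {k} (evenVertex i) ≡ 0
oddIndicator-evenVertex {k} i = ≡.cong (λ r → ⟦ proj₂ r Fin.≟ zero ⟧) (Fin.remQuot-combine {k} {2} i (suc zero))

∑-vertices : ∀ k (h : Fin (k ℕ.* 2) → ℕ) → ∑ h ≡ ∑ λ (i : Fin k) → h (oddVertex i) ℕ.+ h (evenVertex i)
∑-vertices zero    h = ≡.refl
∑-vertices (suc k) h = ≡.trans (≡.sym (ℕ.+-assoc (h zero) _ _))
  (≡.cong (h zero ℕ.+ h (suc zero) ℕ.+_) (∑-vertices k (λ v → h (suc (suc v)))))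

∑-oddIndicator : ∀ k (h : Fin (k ℕ.* 2) → ℕ) → (∑ λ v → oddIndicator {k} v ℕ.* h v) ≡ ∑ λ (i : Fin k) → h (oddVertex i)
∑-oddIndicator k h = ≡.trans (∑-vertices k (λ v → oddIndicator {k} v ℕ.* h v)) (∑.sum-cong-≗ pointwise)
  where
  pointwise : ∀ (i : Fin k) →
    oddIndicator {k} (oddVertex i) ℕ.* h (oddVertex i) ℕ.+ oddIndicator {k} (evenVertex i) ℕ.* h (evenVertex i)
      ≡ h (oddVertex i)
  pointwise i = ≡.trans
    (≡.cong₂ (λ a b → a ℕ.* h (oddVertex i) ℕ.+ b ℕ.* h (evenVertex i))
      (oddIndicator-oddVertex i) (oddIndicator-evenVertex i))
    (≡.trans (ℕ.+-identityʳ _) (ℕ.+-identityʳ _))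

module _ {N} (G : SimpleGraph N) where
  open SimpleGraph G

  degree≡∑ : ∀ u → degree G u ≡ ∑ λ v → ⟦ adj? u v ⟧
  degree≡∑ u = length-filter-tabulate (adj? u) id

  degree>0 : ∀ {u v} → Adj u v → 0 ℕ.< degree G u
  degree>0 {u} {v} uv = List.filter-some (adj? u) (lose (∈-allFin v) uv)

  edge? : ∀ u v → Dec (u Fin.< v × Adj u v)
  edge? u v = (u Fin.<? v) ×-dec adj? u v

  -- Irreflexivity excludes `u ≡ v`, so an adjacent pair is increasing in exactly one of its two
  -- orders.
  edge-orientations : ∀ u v → ⟦ edge? u v ⟧ ℕ.+ ⟦ edge? v u ⟧ ≡ ⟦ adj? u v ⟧
  edge-orientations u v = orientations (adj? u v)
    where
    orientations : (uv? : Dec (Adj u v)) → ⟦ edge? u v ⟧ ℕ.+ ⟦ edge? v u ⟧ ≡ ⟦ uv? ⟧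
    orientations (no ¬uv) = ≡.cong₂ ℕ._+_
      (⟦⟧-false (edge? u v) (¬uv ∘ proj₂)) (⟦⟧-false (edge? v u) (¬uv ∘ sym ∘ proj₂))
    orientations (yes uv) with Fin.<-cmp u v
    ... | tri< u<v _ u≯v = ≡.cong₂ ℕ._+_
      (⟦⟧-true (edge? u v) (u<v , uv)) (⟦⟧-false (edge? v u) (u≯v ∘ proj₁))
    ... | tri≈ _ u≡v _   = contradiction uv (irrefl u≡v)
    ... | tri> u≮v _ v<u = ≡.cong₂ ℕ._+_
      (⟦⟧-false (edge? u v) (u≮v ∘ proj₁)) (⟦⟧-true (edge? v u) (v<u , sym uv))

-- Every edge has exactly one odd endpoint, and is counted there.
∑-degree-odd : ∀ k (G : SimpleGraph (k ℕ.* 2)) → EdgesJoin G (OddVertex k) (EvenVertex k) →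
               (∑ λ (i : Fin k) → degree G (oddVertex i)) ≡ length (edges G)
∑-degree-odd k G joins = ≡.sym (begin
  length (edges G)
    ≡⟨ length-filter-cartesianProduct (λ (u , v) → edge? G u v) id id ⟩
  (∑ λ u → ∑ λ v → E u v)
    ≡⟨ ∑.sum-cong-≗ (λ u → ≡.trans (∑.sum-cong-≗ (split u)) (∑.∑-distrib-+ (λ v → o u ℕ.* E u v) _)) ⟩
  (∑ λ u → (∑ λ v → o u ℕ.* E u v) ℕ.+ (∑ λ v → o v ℕ.* E u v))
    ≡⟨ ∑.∑-distrib-+ (λ u → ∑ λ v → o u ℕ.* E u v) _ ⟩
  (∑ λ u → ∑ λ v → o u ℕ.* E u v) ℕ.+ (∑ λ u → ∑ λ v → o v ℕ.* E u v)
    -- Exchanging the order of summation in the second sum brings edges of both orientations to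
    -- their odd endpoint `u`.
    ≡⟨ ≡.cong ((∑ λ u → ∑ λ v → o u ℕ.* E u v) ℕ.+_) (∑.∑-comm λ u v → o v ℕ.* E u v) ⟩
  (∑ λ u → ∑ λ v → o u ℕ.* E u v) ℕ.+ (∑ λ u → ∑ λ v → o u ℕ.* E v u)
    ≡⟨ ∑.∑-distrib-+ (λ u → ∑ λ v → o u ℕ.* E u v) _ ⟨
  (∑ λ u → (∑ λ v → o u ℕ.* E u v) ℕ.+ (∑ λ v → o u ℕ.* E v u))
    ≡⟨ ∑.sum-cong-≗ atVertex ⟩
  (∑ λ u → o u ℕ.* degree G u)
    ≡⟨ ∑-oddIndicator k (degree G) ⟩
  (∑ λ (i : Fin k) → degree G (oddVertex i)) ∎)
  where
  open ≡.≡-Reasoning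
  o = oddIndicator {k}
  E : Fin (k ℕ.* 2) → Fin (k ℕ.* 2) → ℕ
  E u v = ⟦ edge? G u v ⟧
  one-odd : ∀ {u v} → SimpleGraph.Adj G u v → o u ℕ.+ o v ≡ 1
  one-odd {u} {v} uv with joins u v uv
  ... | inj₁ ((i , ≡.refl) , (j , ≡.refl)) = ≡.cong₂ ℕ._+_ (oddIndicator-oddVertex i) (oddIndicator-evenVertex j)
  ... | inj₂ ((i , ≡.refl) , (j , ≡.refl)) = ≡.cong₂ ℕ._+_ (oddIndicator-evenVertex i) (oddIndicator-oddVertex j)
  split : ∀ u v → E u v ≡ o u ℕ.* E u v ℕ.+ o v ℕ.* E u v
  split u v = ≡.trans (counted (edge? G u v)) (ℕ.*-distribʳ-+ (E u v) (o u) (o v))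
    where
    counted : (e? : Dec (u Fin.< v × SimpleGraph.Adj G u v)) → ⟦ e? ⟧ ≡ (o u ℕ.+ o v) ℕ.* ⟦ e? ⟧
    counted (yes (_ , uv)) = ≡.sym (≡.trans (ℕ.*-identityʳ _) (one-odd uv))
    counted (no  _)        = ≡.sym (ℕ.*-zeroʳ (o u ℕ.+ o v))
  atVertex : ∀ u → (∑ λ v → o u ℕ.* E u v) ℕ.+ (∑ λ v → o u ℕ.* E v u) ≡ o u ℕ.* degree G u
  atVertex u = begin
    (∑ λ v → o u ℕ.* E u v) ℕ.+ (∑ λ v → o u ℕ.* E v u)  ≡⟨ ∑.∑-distrib-+ (λ v → o u ℕ.* E u v) _ ⟨
    (∑ λ v → o u ℕ.* E u v ℕ.+ o u ℕ.* E v u)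
      ≡⟨ ∑.sum-cong-≗ (λ v → ≡.trans (≡.sym (ℕ.*-distribˡ-+ (o u) (E u v) _))
           (≡.cong (o u ℕ.*_) (edge-orientations G u v))) ⟩
    (∑ λ v → o u ℕ.* ⟦ SimpleGraph.adj? G u v ⟧)           ≡⟨ ∑.*-distribˡ-sum (o u) (λ v → ⟦ SimpleGraph.adj? G u v ⟧) ⟨
    o u ℕ.* (∑ λ v → ⟦ SimpleGraph.adj? G u v ⟧)           ≡⟨ ≡.cong (o u ℕ.*_) (degree≡∑ G u) ⟨
    o u ℕ.* degree G u                                   ∎

-- Homogeneous polynomials and replacement of monomials modulo an ideal.

module _ {c ℓ} (K : CommutativeRing c ℓ) where
  open CommutativeRing K hiding (zero)
  open Polynomials K
  open Binomials K
  open Exp semiring using (_^_)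
  open SetoidReasoning setoid

  binomial-homogeneous : ∀ {s d} (u v : Monomial s) → Vec.sum u ≡ d → Vec.sum v ≡ d →
                         Homogeneous K d (binomial u v)
  binomial-homogeneous u v sum-u sum-v m sum-m =
    coeff-∉ {p = binomial u v} ((λ { ≡.refl → sum-m sum-u }) ∷ (λ { ≡.refl → sum-m sum-v }) ∷ [])

  -- `Homogeneous` speaks of coefficients, so the list may still contain cancelling terms of other
  -- degrees. Discarding them gives every listed term degree `d`.
  homogeneousPart : ∀ {s} → ℕ → Poly K s → Poly K s
  homogeneousPart d = select λ m → Vec.sum m ℕ.≟ d

  homogeneousPart-≋ : ∀ {s d} {p : Poly K s} → Homogeneous K d p → p ≋ homogeneousPart d p
  homogeneousPart-≋ {d = d} {p} hom = ≈ₚ⇒≋ λ m → coeffs m (Vec.sum m ℕ.≟ d)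
    where
    coeffs : ∀ m → Dec (Vec.sum m ≡ d) → coeff K p m ≈ coeff K (homogeneousPart d p) m
    coeffs m (yes sum-m) = sym (coeff-select-∈ (λ m → Vec.sum m ℕ.≟ d) p sum-m)
    coeffs m (no  sum-m) = trans (hom m sum-m) (sym (coeff-select-∉ (λ m → Vec.sum m ℕ.≟ d) p sum-m))

  1^n≈1 : ∀ n → 1# ^ n ≈ 1#
  1^n≈1 zero    = refl
  1^n≈1 (suc n) = trans (*-identityˡ _) (1^n≈1 n)

  eval-agree : ∀ {s} {p : Poly K s} {x y} → All (λ (_ , m) → ∀ i → lookup m i ≡ 0 ⊎ x i ≈ y i) p →
               eval K p x ≈ eval K p y
  eval-agree []                                = refl
  eval-agree {p = (a , m) ∷ p} (m-agrees ∷ p-agrees) =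
    +-cong (*-congˡ (evalMonomial-cong m m-agrees)) (eval-agree p-agrees)

  -- `h` collects the errors, `a` times `binomial m (g m)` for each term `(a , m)` of `p`.
  scale-congruent : ∀ {s γ} {G : Pred (Poly K s) γ} (g : Monomial s → Monomial s) →
                    (∀ m → Ideal G (binomial m (g m))) →
                    ∀ p → ∃[ h ] Ideal G h × p ≋ h +ₚ scale 1# g p
  scale-congruent g congruent []            = 0ₚ , 0∈ , ≋-refl
  scale-congruent g congruent ((a , m) ∷ p) =
    let h , h∈ , p≋ = scale-congruent g congruent p
    in term a 𝟘 *ₚ binomial m (g m) +ₚ h , +-closed (*-closed (term a 𝟘) (congruent m)) h∈ , ≋-from-lin λ φ → begin
      a * φ m + lin φ p
        ≈⟨ +-cong (split φ) (trans (lin-cong φ p≋) (lin-++ φ h (scale 1# g p))) ⟩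
      lin φ (term a 𝟘 *ₚ binomial m (g m)) + 1# * a * φ (g m) + (lin φ h + lin φ (scale 1# g p))
        ≈⟨ interchange _ _ _ _ ⟩
      lin φ (term a 𝟘 *ₚ binomial m (g m)) + lin φ h + lin φ (scale 1# g ((a , m) ∷ p))
        ≈⟨ +-congʳ (lin-++ φ (term a 𝟘 *ₚ binomial m (g m)) h) ⟨
      lin φ (term a 𝟘 *ₚ binomial m (g m) ++ h) + lin φ (scale 1# g ((a , m) ∷ p))
        ≈⟨ lin-++ φ (term a 𝟘 *ₚ binomial m (g m) ++ h) _ ⟨
      lin φ ((term a 𝟘 *ₚ binomial m (g m) +ₚ h) +ₚ scale 1# g ((a , m) ∷ p)) ∎
    where
    open CommutativeSemigroupProperties +-commutativeSemigroup using (interchange)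
    split : ∀ φ → a * φ m ≈ lin φ (term a 𝟘 *ₚ binomial m (g m)) + 1# * a * φ (g m)
    split φ = sym (begin
      lin φ (term a 𝟘 *ₚ binomial m (g m)) + 1# * a * φ (g m)
        ≈⟨ +-cong (trans (lin-*ₚ-binomial φ (term a 𝟘) m (g m)) (+-identityʳ _)) (*-congʳ (*-identityˡ a)) ⟩
      a * (φ (𝟘 ⊕ m) - φ (𝟘 ⊕ g m)) + a * φ (g m)
        ≈⟨ distribˡ a _ _ ⟨
      a * (φ (𝟘 ⊕ m) - φ (𝟘 ⊕ g m) + φ (g m))
        ≈⟨ *-congˡ (+-congʳ (+-cong (≡⇒φ φ (⊕-identityˡ m)) (-‿cong (≡⇒φ φ (⊕-identityˡ (g m)))))) ⟩
      a * (φ m - φ (g m) + φ (g m))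
        ≈⟨ *-congˡ (trans (+-assoc _ _ _) (trans (+-congˡ (-‿inverseˡ _)) (+-identityʳ _))) ⟩
      a * φ m ∎)

-- Dehomogenization, and the vanishing ideal for a given partition into blocks.

module _ {c ℓ} (K : CommutativeRing c ℓ) {q-1} (isFiniteField : IsFiniteField K (suc q-1)) where
  open CommutativeRing K hiding (zero)
  open IsFiniteField isFiniteField
  open Polynomials K
  open Binomials K
  open FiniteField K isFiniteField
  open Exp semiring using (_^_; ^-congˡ)

  -- In a fixed degree the exponent of the first variable is determined by the others, so setting
  -- that variable to 1 merges no two monomials.
  coeff-dehomogenize : ∀ {s d} {p : Poly K (suc s)} → All (λ (_ , m) → Vec.sum m ≡ d) p →
                       ∀ n m → n ℕ.+ Vec.sum m ≡ d → coeff K p (n ∷ m) ≈ coeff K (substitute 1# p) m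
  coeff-dehomogenize []                                n m eq = refl
  coeff-dehomogenize {p = (a , n′ ∷ u) ∷ p} (sum-u ∷ sum-p) n m eq =
    +-cong (head (u ≟ₘ m)) (coeff-dehomogenize sum-p n m eq)
    where
    head : (u≟m : Dec (u ≡ m)) → (if does ((n′ ∷ u) ≟ₘ (n ∷ m)) then a else 0#) ≈
                                 (if does u≟m then a * 1# ^ n′ else 0#)
    head (no u≢m) rewrite dec-false ((n′ ∷ u) ≟ₘ (n ∷ m)) (u≢m ∘ Vec.∷-injectiveʳ) = refl
    head (yes ≡.refl)
      rewrite dec-true ((n′ ∷ u) ≟ₘ (n ∷ u))
                (≡.cong (_∷ u) (ℕ.+-cancelʳ-≡ (Vec.sum u) n′ n (≡.trans sum-u (≡.sym eq)))) =
      sym (trans (*-congˡ (1^n≈1 K n′)) (*-identityʳ a))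

  substitute≈0⇒≈0 : ∀ {s d} {p : Poly K (suc s)} → All (λ (_ , m) → Vec.sum m ≡ d) p →
                    substitute 1# p ≈ₚ 0ₚ → p ≈ₚ 0ₚ
  substitute≈0⇒≈0 {d = d} sum-p p≈0 (n ∷ m) with n ℕ.+ Vec.sum m ℕ.≟ d
  ... | yes eq = trans (coeff-dehomogenize sum-p n m eq) (p≈0 m)
  ... | no neq = coeff-∉ (All.map (λ { sum-u ≡.refl → neq sum-u }) sum-p)

  module Blocks {k r} (n : Fin (suc k) → ℕ) (n>0 : ∀ j → 0 ℕ.< n j) (∑n≡s : ∑ n ≡ suc r) where

    inSomeBlock : ∀ (x : Fin (suc r)) → ∃[ j ] InBlock n j x
    inSomeBlock x = findBlock n (≡.subst (toℕ x ℕ.<_) (≡.sym ∑n≡s) (Fin.toℕ<n x))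

    block : Fin (suc r) → Fin (suc k)
    block x = proj₁ (inSomeBlock x)

    block-unique : ∀ {x j} → InBlock n j x → block x ≡ j
    block-unique {x} = InBlock-unique n (proj₂ (inSomeBlock x))

    start<start+n : ∀ j → start n j ℕ.< start n j ℕ.+ n j
    start<start+n j = ℕ.m<m+n (start n j) (n>0 j)

    start<s : ∀ j → start n j ℕ.< suc r
    start<s j = ℕ.<-≤-trans (start<start+n j) (≡.subst (start n j ℕ.+ n j ℕ.≤_) ∑n≡s (start-∑ n j))

    first : Fin (suc k) → Fin (suc r)
    first j = fromℕ< (start<s j)

    toℕ-first : ∀ j → toℕ (first j) ≡ start n j
    toℕ-first j = Fin.toℕ-fromℕ< (start<s j)

    start-inBlock : ∀ {x : Fin (suc r)} {j} → toℕ x ≡ start n j → InBlock n j x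
    start-inBlock {j = j} eq = ℕ.≤-reflexive (≡.sym eq) , ≡.subst (ℕ._< _) (≡.sym eq) (start<start+n j)

    block-first : ∀ j → block (first j) ≡ j
    block-first j = block-unique {first j} (start-inBlock {first j} (toℕ-first j))

    IsFirst : Pred (Fin (suc r)) _
    IsFirst x = toℕ x ≡ start n (block x)

    isFirst? : ∀ x → Dec (IsFirst x)
    isFirst? x = toℕ x ℕ.≟ start n (block x)

    first-block : ∀ {x} → IsFirst x → first (block x) ≡ x
    first-block {x} eq = Fin.toℕ-injective (≡.trans (toℕ-first (block x)) (≡.sym eq))

    zero-isFirst : IsFirst zero
    zero-isFirst = ≡.sym (ℕ.n≤0⇒n≡0 (proj₁ (proj₂ (inSomeBlock zero))))

    ¬isFirst⇒start< : ∀ {x} → ¬ IsFirst x → start n (block x) ℕ.< toℕ x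
    ¬isFirst⇒start< {x} ¬first = ℕ.≤∧≢⇒< (proj₁ (proj₂ (inSomeBlock x))) (¬first ∘ ≡.sym)

    -- The decision is an argument so that one match on `isFirst? (suc i)` makes `exponent`,
    -- `partner` and `node` compute together.
    exponent : ∀ {x} → Dec (IsFirst x) → ℕ
    exponent (yes _) = q-1
    exponent (no  _) = 1

    partner : ∀ {x} → Dec (IsFirst x) → Fin (suc r)
    partner     (yes _) = zero
    partner {x} (no  _) = first (block x)

    e : Fin r → ℕ
    e i = exponent (isFirst? (suc i))

    b : Fin r → Fin (suc r)
    b i = partner (isFirst? (suc i))

    e≢0 : ∀ i → NonZero (e i)
    e≢0 i with isFirst? (suc i)
    ... | yes _ = order≢0
    ... | no  _ = _

    b≤ : ∀ i → toℕ (b i) ℕ.≤ toℕ i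
    b≤ i with isFirst? (suc i)
    ... | yes _     = ℕ.z≤n
    ... | no ¬first = ≡.subst (ℕ._≤ toℕ i) (≡.sym (toℕ-first (block (suc i)))) (ℕ.s≤s⁻¹ (¬isFirst⇒start< ¬first))

    open Triangular e b e≢0 b≤ public

    Y : Pred (ProjectivePoint K (suc r)) _
    Y = 𝕐 K (suc r) n

    -- The scalar `u` of `P ∼ Q` is absorbed into the parameters, so every representative of a point
    -- of `Y` has the block form itself.
    coord-𝕐 : ∀ {P} → Y P → ∃[ t ] (∀ j → ¬ t j ≈ 0#) × (∀ x → coord P x ≈ t (block x))
    coord-𝕐 (t , t≉0 , Q , Q≈t , u , u≉0 , P≈uQ) =
      (λ j → u * t j) , (λ j → *-≉0 u≉0 (t≉0 j)) ,
      λ x → trans (P≈uQ x) (*-congˡ (Q≈t (block x) x (proj₂ (inSomeBlock x))))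

    -- At the first coordinate of a block both powers are 1 by `fermat`; at any other coordinate the
    -- two variables lie in the same block and take equal values.
    f-vanishes : ∀ {P} → Y P → ∀ i → eval K (f i) (coord P) ≈ 0#
    f-vanishes {P} P∈Y i = trans (eval-binomial (power (suc i) (e i)) (power (b i) (e i)) (coord P))
      (trans (+-cong (trans (evalMonomial-power (suc i) (e i) (coord P)) powers-agree)
          (-‿cong (evalMonomial-power (b i) (e i) (coord P))))
        (-‿inverseʳ _))
      where
      t   = proj₁ (coord-𝕐 {P} P∈Y)
      t≉0 = proj₁ (proj₂ (coord-𝕐 {P} P∈Y))
      P≈t = proj₂ (proj₂ (coord-𝕐 {P} P∈Y))
      P≉0 : ∀ x → ¬ coord P x ≈ 0#
      P≉0 x = t≉0 (block x) ∘ trans (sym (P≈t x))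
      powers-agree : coord P (suc i) ^ e i ≈ coord P (b i) ^ e i
      powers-agree with isFirst? (suc i)
      ... | yes _ = trans (fermat (P≉0 (suc i))) (sym (fermat (P≉0 zero)))
      ... | no  _ = ^-congˡ 1 (trans (P≈t (suc i)) (trans
        (reflexive (≡.cong t (≡.sym (block-first (block (suc i)))))) (sym (P≈t (first (block (suc i)))))))

    ideal-f⊆vanishing : ∀ {h} → Ideal IsF h → VanishingIdeal K Y h
    ideal-f⊆vanishing = generated⊆ λ {h} (i , h≈f) → ≋-closed (≋-sym (≈ₚ⇒≋ {p = h} h≈f)) (generator {x = f i}
      ( (e i , binomial-homogeneous K (power (suc i) (e i)) (power (b i) (e i))
                 (sum-power (suc i) (e i)) (sum-power (b i) (e i)))
      , λ P P∈Y → f-vanishes {P} P∈Y i ))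

    -- As many nodes as the exponent bound: all `q - 1` nonzero elements at the first coordinate of
    -- a block, and a single value elsewhere, where a reduced exponent is below 1.
    node : ∀ {x} (first? : Dec (IsFirst x)) → Vector Carrier (exponent first?)
    node (yes _) = unit
    node (no  _) = λ _ → 1#

    node≉0 : ∀ {x} (first? : Dec (IsFirst x)) j → ¬ node first? j ≈ 0#
    node≉0 (yes _) j = unit≉0 j
    node≉0 (no  _) j = 0≉1 ∘ sym

    node-injective : ∀ {x} (first? : Dec (IsFirst x)) {i j} → node first? i ≈ node first? j → i ≡ j
    node-injective (yes _) eq = unit-injective eq
    node-injective (no  _) {zero} {zero} eq = ≡.refl

    module _ (g : ∀ i → Fin (e i)) where

      gridCoord : Vector Carrier (suc r)
      gridCoord zero    = 1#
      gridCoord (suc i) = node (isFirst? (suc i)) (g i)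

      gridCoord≉0 : ∀ x → ¬ gridCoord x ≈ 0#
      gridCoord≉0 zero    = 0≉1 ∘ sym
      gridCoord≉0 (suc i) = node≉0 (isFirst? (suc i)) (g i)

      -- `gridCoord` is 1 at the coordinates that are not first, so it need not have the block form.
      -- Copying the first coordinate of each block over the block gives a point of `Y`, on which
      -- reduced monomials take the same values.
      gridPoint : ProjectivePoint K (suc r)
      gridPoint = record
        { coord   = λ x → gridCoord (first (block x))
        ; nonzero = zero , gridCoord≉0 (first (block zero))
        }

      gridPoint∈Y : Y gridPoint
      gridPoint∈Y = gridCoord ∘ first , (λ j → gridCoord≉0 (first j)) , gridPoint
        , (λ j x x∈j → reflexive (≡.cong (gridCoord ∘ first) (block-unique {x} x∈j)))
        , 1# , 0≉1 ∘ sym , λ x → sym (*-identityˡ _)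

      reduced-agree : ∀ {m} → Reduced m → ∀ x → lookup m x ≡ 0 ⊎ gridCoord x ≈ coord gridPoint x
      reduced-agree m<e zero    = inj₂ (reflexive (≡.cong gridCoord (≡.sym (first-block zero-isFirst))))
      reduced-agree {m} m<e (suc i) = agree (isFirst? (suc i)) (m<e i)
        where
        agree : (first? : Dec (IsFirst (suc i))) → lookup m (suc i) ℕ.< exponent first? →
                lookup m (suc i) ≡ 0 ⊎ gridCoord (suc i) ≈ coord gridPoint (suc i)
        agree (yes isFirst) _   = inj₂ (reflexive (≡.cong gridCoord (≡.sym (first-block isFirst))))
        agree (no  _)       m<1 = inj₁ (ℕ.n<1⇒n≡0 m<1)

    -- Reduced monomials involve only the first variables of the blocks, and
    -- with the first variable set to 1 the points of Y restrict to a grid.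
    reduced-vanishing⇒≈0 : ∀ {d} (p : Poly K (suc r)) → All (λ (_ , m) → Vec.sum m ≡ d) p →
      All (λ (_ , m) → Reduced m) p → (∀ P → Y P → eval K p (coord P) ≈ 0#) → p ≈ₚ 0ₚ
    reduced-vanishing⇒≈0 p sum-p reduced-p p≈0 = substitute≈0⇒≈0 sum-p
      (vanishing-on-grid e (λ i → node (isFirst? (suc i))) (λ i → node-injective (isFirst? (suc i)))
        (substitute 1# p)
        (All.map⁺ (All.map (λ { {_ , _ ∷ _} m<e → m<e }) reduced-p))
        λ g → trans (eval-substitute p (gridCoord g))
          (trans (eval-agree K (All.map (λ {(_ , m)} → reduced-agree g {m}) reduced-p))
            (p≈0 (gridPoint g) (gridPoint∈Y g))))

    -- A homogeneous generator `p` is `h` from the ideal plus the reduced part `ρ`. Since `p` and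
    -- `h` vanish on `Y`, so does `ρ`, which is then zero, leaving `p` equal to `h`.
    vanishing⊆ideal-f : ∀ {h} → VanishingIdeal K Y h → Ideal IsF h
    vanishing⊆ideal-f = generated⊆ λ { {p} ((d , hom) , p≈0) → vanishing-homogeneous p d hom p≈0 }
      where
      vanishing-homogeneous : ∀ p d → Homogeneous K d p → (∀ P → Y P → eval K p (coord P) ≈ 0#) → Ideal IsF p
      vanishing-homogeneous p d hom p≈0 =
        let h , h∈ , p′≋ = scale-congruent K reduce reduce-congruent p′
            p≋ = ≋-trans (homogeneousPart-≋ K hom) p′≋
            ρ≈0 = reduced-vanishing⇒≈0 ρ
              (All.map⁺ (All.map (λ {(_ , m)} sum-m → ≡.trans (sum-reduce m) sum-m) (select-all (λ m → Vec.sum m ℕ.≟ d) p)))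
              (All.map⁺ (All.universal (λ (_ , m) → reduce-reduced m) p′))
              λ P P∈Y → begin
                eval K ρ (coord P)
                  ≈⟨ +-identityˡ _ ⟨
                0# + eval K ρ (coord P)
                  ≈⟨ +-congʳ (eval-ideal (coord P) (λ {g} (i , g≈f) →
                       trans (eval-cong {p = g} {f i} (coord P) (≈ₚ⇒≋ g≈f)) (f-vanishes {P} P∈Y i)) h∈) ⟨
                eval K h (coord P) + eval K ρ (coord P)
                  ≈⟨ eval-++ h ρ (coord P) ⟨
                eval K (h +ₚ ρ) (coord P)
                  ≈⟨ eval-cong (coord P) p≋ ⟨
                eval K p (coord P)
                  ≈⟨ p≈0 P P∈Y ⟩
                0# ∎
        in ≋-closed (≋-sym p≋) (+-closed h∈ (≋-closed (≋-sym (≈ₚ⇒≋ {p = ρ} ρ≈0)) 0∈))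
        where
        open SetoidReasoning setoid
        p′ = homogeneousPart K d p
        ρ = scale 1# reduce p′

    f-first : ∀ {i} → IsFirst (suc i) → f i ≡ binomial (power (suc i) q-1) (power zero q-1)
    f-first {i} isFirst with isFirst? (suc i)
    ... | yes _     = ≡.refl
    ... | no ¬first = contradiction isFirst ¬first

    f-other : ∀ {i} → ¬ IsFirst (suc i) → f i ≡ X K (suc i) +ₚ -ₚ X K (first (block (suc i)))
    f-other {i} ¬first with isFirst? (suc i)
    ... | yes isFirst = contradiction isFirst ¬first
    ... | no _        = ≡.refl

    generator⇒f : ∀ {h} → generators K (suc q-1) (suc r) n h → IsF h
    -- Block 0 is nonempty, so no later block starts at coordinate 0.
    generator⇒f (inj₁ (j , zero , o , j≥1 , a≡ , o≡0 , h≈)) =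
      contradiction (ℕ.<-≤-trans (n>0 zero) (start-suc n j≥1)) λ lt → ℕ.<-irrefl a≡ lt
    generator⇒f {h} (inj₁ (j , suc i , zero , j≥1 , a≡ , o≡0 , h≈)) =
      i , ≋⇒≈ₚ (≋-trans (≈ₚ⇒≋ {p = h} h≈) (≋-trans (X^-X^≋binomial (suc i) zero q-1)
        (≋-reflexive (≡.sym (f-first (≡.trans a≡
          (≡.cong (start n) (≡.sym (block-unique {suc i} (start-inBlock {suc i} {j} a≡))))))))))
    generator⇒f {h} (inj₂ (j , a , suc i , a≡ , start< , <start+n , h≈)) =
      i , ≋⇒≈ₚ (≋-trans (≈ₚ⇒≋ {p = h} h≈) (≋-reflexive (≡.sym (≡.trans (f-other ¬first)
        (≡.cong (λ a → X K (suc i) +ₚ -ₚ X K a) first≡a)))))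
      where
      block≡j : block (suc i) ≡ j
      block≡j = block-unique {suc i} (ℕ.<⇒≤ start< , <start+n)
      ¬first : ¬ IsFirst (suc i)
      ¬first isFirst = ℕ.<-irrefl (≡.trans (≡.cong (start n) (≡.sym block≡j)) (≡.sym isFirst)) start<
      first≡a : first (block (suc i)) ≡ a
      first≡a = Fin.toℕ-injective (≡.trans (toℕ-first (block (suc i))) (≡.trans (≡.cong (start n) block≡j) (≡.sym a≡)))

    f⇒generator : ∀ {h} → IsF h → generators K (suc q-1) (suc r) n h
    f⇒generator {h} (i , h≈f) = go (isFirst? (suc i))
      where
      go : Dec (IsFirst (suc i)) → generators K (suc q-1) (suc r) n h
      go (yes isFirst) = inj₁ (block (suc i) , suc i , zero , positive (block (suc i)) isFirst , isFirst , ≡.refl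
        , ≋⇒≈ₚ (≋-trans (≈ₚ⇒≋ {p = h} h≈f)
            (≋-trans (≋-reflexive (f-first isFirst)) (≋-sym (X^-X^≋binomial (suc i) zero q-1)))))
        where
        positive : ∀ j → suc (toℕ i) ≡ start n j → 1 ℕ.≤ toℕ j
        positive (suc j) _ = ℕ.s≤s ℕ.z≤n
      go (no ¬first) = inj₂ (block (suc i) , first (block (suc i)) , suc i , toℕ-first (block (suc i))
        , ¬isFirst⇒start< ¬first , proj₂ (proj₂ (inSomeBlock (suc i)))
        , ≋⇒≈ₚ (≋-trans (≈ₚ⇒≋ {p = h} h≈f) (≋-reflexive (f-other ¬first))))

    completeIntersection : IsCompleteIntersection K Y
    completeIntersection = f , f-regular , vanishing⊆ideal-f , ideal-f⊆vanishing

    vanishingIdeal≐generated : VanishingIdeal K Y ≐ Ideal (generators K (suc q-1) (suc r) n)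
    vanishingIdeal≐generated =
      (λ h∈ → generated⊆ (λ {h} → generator ∘ f⇒generator {h}) (vanishing⊆ideal-f h∈)) ,
      (λ h∈ → ideal-f⊆vanishing (generated⊆ (λ {h} → generator ∘ generator⇒f {h}) h∈))

-- From the graph to its blocks of coordinates.

open import Data.Nat.Base using (_*_)

theorem4p1 : ∀ {c ℓ} (K : CommutativeRing c ℓ) (q : ℕ) → IsFiniteField K q →
  ∀ (k s : ℕ) .{{_ : NonZero k}} (G : SimpleGraph (k * 2)) →
  length (edges G) ≡ s →
  EdgesJoin G (OddVertex k) (EvenVertex k) →
  IsPerfectMatching G (λ (i : Fin k) → oddVertex i , evenVertex i) →
  let n : Fin k → ℕ
      n = degree G ∘ oddVertex
  in IsCompleteIntersection K (𝕐 K s n) ×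
     (VanishingIdeal K (𝕐 K s n) ≐ GeneratedIdeal (polynomialRing K s) (generators K q s n))
-- An enumeration by `Fin 0` would leave no index for `0#`.
theorem4p1 K zero F k s G edges≡s joins matching =
  contradiction (Inverse.from (IsFiniteField.enumeration F) (CommutativeRing.0# K)) λ ()
-- The first matching edge gives its odd endpoint positive degree, so the number of edges, as the
-- sum of these degrees, cannot be 0.
theorem4p1 K (suc q-1) F (suc k) zero G edges≡0 joins (matched , _) =
  contradiction (≡.trans (∑-degree-odd (suc k) G joins) edges≡0)
    (ℕ.>⇒≢ (ℕ.<-≤-trans (degree>0 G (matched zero)) (ℕ.m≤m+n _ _)))
theorem4p1 K (suc q-1) F (suc k) (suc r) G edges≡s joins (matched , _) =
  completeIntersection , vanishingIdeal≐generated
  where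
  open Blocks K F (degree G ∘ oddVertex) (λ j → degree>0 G (matched j))
    (≡.trans (∑-degree-odd (suc k) G joins) edges≡s)
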